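{- For every $m\ge1$, each of the sequences $\big(\#\Pi_n(1/2/\ldots/m)\big)_{n\ge0}$, $\big(\#\Pi_n(12\ldots m)\big)_{n\ge0}$ and $\big(\#\Pi_n(12/3/4/\ldots/m)\big)_{n\ge0}$ (the last for $m\ge2$) is P-recursive. Furthermore, for every partition $\pi$ of $[3]$, the sequence $\big(\#\Pi_n(\pi)\big)_{n\ge0}$ is P-recursive.
   Context: $\Pi_n$ is the set of partitions of $[n]=\{1,\ldots,n\}$, written with slashes between blocks. Standardization $\mathrm{st}$ is the order-preserving bijection of a finite integer set onto $[\#S]$. A subpartition of $\sigma$ is a partition each of whose blocks lies in a different block of $\sigma$; $\sigma$ contains $\pi$ if some subpartition $\sigma'$ has $\mathrm{st}(\sigma')=\pi$, else avoids $\pi$; $\Pi_n(\pi)$ is the set of $\sigma\in\Pi_n$ avoiding $\pi$. $1/2/\ldots/m$ is the all-singletons partition of $[m]$, $12\ldots m$ the one-block partition, $12/3/\ldots/m$ has blocks $\{1,2\},\{3\},\ldots,\{m\}$. A sequence $(a_n)$ is P-recursive if there are polynomials $P_0,\ldots,P_k$, not all zero, with $\sum_{i=0}^kP_i(n)a_{n+i}=0$ for all $n\ge0$. -}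

module Defs where

open import Algebra.Properties.Monoid.Sum using (sum)
open import Data.Bool.Base using (true; false)
open import Data.Fin.Base as Fin using (Fin; zero; suc; toℕ)
open import Data.Fin.Permutation using (↔⇒≡)
open import Data.Fin.Subset
open import Data.Fin.Subset.Properties
open import Data.Integer.Base as ℤ using (ℤ; +_; 0ℤ)
import Data.Integer.Properties as ℤ
open import Data.List.Base as List using (List; []; _∷_; length; tabulate)
open import Data.List.Relation.Unary.All as All using (All; []; _∷_)
import Data.List.Relation.Unary.All.Properties as All
open import Data.List.Relation.Unary.AllPairs using (AllPairs; []; _∷_)
import Data.List.Relation.Unary.AllPairs.Properties as AllPairs
open import Data.List.Relation.Unary.Any using (Any; here; there)
import Data.List.Relation.Unary.Any.Properties as Any
open import Data.List.Relation.Binary.Permutation.Propositional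
  using (_↭_; ↭-isEquivalence)
open import Data.Nat.Base as ℕ using (ℕ; zero; suc; s≤s; z<s; s<s)
open import Data.Product.Base using (Σ; ∃; _×_; _,_; proj₁)
open import Data.Sum.Base using (inj₁; inj₂)
open import Data.Vec.Base using ([]; _∷_; here; there)
open import Function.Base using (_on_)
open import Function.Bundles using (Inverse)
open import Function.Definitions using (Injective)
import Function.Construct.Composition as Comp
import Function.Construct.Symmetry as Symm
open import Level using (0ℓ)
open import Relation.Binary.Bundles using (Setoid)
import Relation.Binary.Construct.On as On
open import Relation.Binary.PropositionalEquality
  using (_≡_; _≢_; refl; sym; trans; cong; subst; setoid)
open import Relation.Nullary.Negation using (¬_; contradiction)

-- [n] is rendered as Fin n, i.e. its elements are numbered from 0.

Disjoint : ∀ {n} → Subset n → Subset n → Set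
Disjoint B C = Empty (B ∩ C)

record PartitionOf {n} (S : Subset n) : Set where
  field
    blocks   : List (Subset n)
    nonempty : All Nonempty blocks
    disjoint : AllPairs Disjoint blocks
    cover    : ⋃ blocks ≡ S

open PartitionOf public

Partition : ℕ → Set
Partition n = PartitionOf (⊤ {n})

-- A partition is a *set* of blocks: two block lists denote the same partition
-- when one is a rearrangement of the other.  (No block is repeated in a list,
-- because blocks are nonempty and pairwise disjoint.)

_≈ᵖ_ : ∀ {n} {S : Subset n} → PartitionOf S → PartitionOf S → Set
σ ≈ᵖ τ = blocks σ ↭ blocks τ

st : ∀ {n} (S : Subset n) {i} → i ∈ S → Fin ∣ S ∣
st (true  ∷ S) here        = zero
st (true  ∷ S) (there i∈S) = suc (st S i∈S)
st (false ∷ S) (there i∈S) = st S i∈S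

st-mono : ∀ {n} (S : Subset n) {i j} (i∈S : i ∈ S) (j∈S : j ∈ S) →
          i Fin.< j → st S i∈S Fin.< st S j∈S
st-mono (true  ∷ S) here        (there j∈S) _         = z<s
st-mono (true  ∷ S) (there i∈S) (there j∈S) (s<s i<j) = s<s (st-mono S i∈S j∈S i<j)
st-mono (false ∷ S) (there i∈S) (there j∈S) (s<s i<j) = st-mono S i∈S j∈S i<j

st-surjective : ∀ {n} (S : Subset n) (k : Fin ∣ S ∣) →
                ∃ λ i → Σ (i ∈ S) λ i∈S → st S i∈S ≡ k
st-surjective (true ∷ S) zero = zero , here , refl
st-surjective (true ∷ S) (suc k) with st-surjective S k
... | i , i∈S , eq = suc i , there i∈S , cong suc eq
st-surjective (false ∷ S) k with st-surjective S k
... | i , i∈S , eq = suc i , there i∈S , eq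

-- The image of B ⊆ S under st, obtained from the characteristic vector of B by
-- deleting the positions outside S; the next two lemmas say it is that image.

stBlock : ∀ {n} (S : Subset n) → Subset n → Subset ∣ S ∣
stBlock []          []      = []
stBlock (true  ∷ S) (b ∷ B) = b ∷ stBlock S B
stBlock (false ∷ S) (_ ∷ B) = stBlock S B

stBlock⁺ : ∀ {n} (S B : Subset n) {i} (i∈S : i ∈ S) →
           i ∈ B → st S i∈S ∈ stBlock S B
stBlock⁺ (true  ∷ S) (_ ∷ B) here        here        = here
stBlock⁺ (true  ∷ S) (_ ∷ B) (there i∈S) (there i∈B) = there (stBlock⁺ S B i∈S i∈B)
stBlock⁺ (false ∷ S) (_ ∷ B) (there i∈S) (there i∈B) = stBlock⁺ S B i∈S i∈B

stBlock⁻ : ∀ {n} (S B : Subset n) {k} → k ∈ stBlock S B →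
           ∃ λ i → Σ (i ∈ S) λ i∈S → i ∈ B × st S i∈S ≡ k
stBlock⁻ []          []      ()
stBlock⁻ (true ∷ S)  (_ ∷ B) here = zero , here , here , refl
stBlock⁻ (true ∷ S)  (_ ∷ B) (there k∈) with stBlock⁻ S B k∈
... | i , i∈S , i∈B , eq = suc i , there i∈S , there i∈B , cong suc eq
stBlock⁻ (false ∷ S) (_ ∷ B) k∈ with stBlock⁻ S B k∈
... | i , i∈S , i∈B , eq = suc i , there i∈S , there i∈B , eq

stBlocks : ∀ {n} {S : Subset n} → PartitionOf S → List (Subset ∣ S ∣)
stBlocks {S = S} σ′ = List.map (stBlock S) (blocks σ′)

-- Blocks are addressed by their positions in the two lists, so injectivity of
-- f says that different blocks of σ′ lie in different blocks of σ.

_IsSubpartitionOf_ : ∀ {n} {S : Subset n} → PartitionOf S → Partition n → Set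
σ′ IsSubpartitionOf σ =
  Σ (Fin (length (blocks σ′)) → Fin (length (blocks σ))) λ f →
    Injective _≡_ _≡_ f ×
    (∀ i → List.lookup (blocks σ′) i ⊆ List.lookup (blocks σ) (f i))

_Contains_ : ∀ {n k} → Partition n → Partition k → Set
_Contains_ {n} {k} σ π =
  Σ (Subset n) λ S → Σ (PartitionOf S) λ σ′ →
    σ′ IsSubpartitionOf σ ×
    Σ (∣ S ∣ ≡ k) λ ∣S∣≡k →
      subst (λ j → List (Subset j)) ∣S∣≡k (stBlocks σ′) ↭ blocks π

_Avoids_ : ∀ {n k} → Partition n → Partition k → Set
σ Avoids π = ¬ (σ Contains π)

Avoiders : ∀ {k} → ℕ → Partition k → Setoid 0ℓ 0ℓ
Avoiders n π = record
  { Carrier       = Σ (Partition n) (_Avoids π)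
  ; _≈_           = _≈ᵖ_ on proj₁
  ; isEquivalence = On.isEquivalence (λ σ → blocks (proj₁ σ)) ↭-isEquivalence
  }

_HasCardinality_ : Setoid 0ℓ 0ℓ → ℕ → Set
A HasCardinality c = Inverse (setoid (Fin c)) A

HasCardinality-unique : ∀ {A c d} → A HasCardinality c → A HasCardinality d → c ≡ d
HasCardinality-unique f g = ↔⇒≡ (Comp.inverse f (Symm.inverse g))

-- Polynomials as coefficient lists, constant term first.  Coefficients are
-- integers: for an integer sequence this yields a recurrence over any larger
-- coefficient ring, and rational coefficients reduce to it by clearing
-- denominators.

Poly : Set
Poly = List ℤ

eval : Poly → ℤ → ℤ
eval []      x = 0ℤ
eval (c ∷ p) x = c ℤ.+ x ℤ.* eval p x

NonZeroPoly : Poly → Set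
NonZeroPoly p = Any (_≢ 0ℤ) p

PRecursive : (ℕ → ℕ) → Set
PRecursive a =
  ∃ λ k → Σ (Fin (suc k) → Poly) λ P →
    (∃ λ i → NonZeroPoly (P i)) ×
    (∀ n → sum ℤ.+-0-monoid (λ i → eval (P i) (+ n) ℤ.* + a (n ℕ.+ toℕ i)) ≡ 0ℤ)

-- The sequence n ↦ #Πₙ(π) exists (each Πₙ(π) is finite) and is P-recursive;
-- by HasCardinality-unique the cardinalities determine the sequence.

CountIsPRecursive : ∀ {k} → Partition k → Set
CountIsPRecursive π =
  ∃ λ (a : ℕ → ℕ) → (∀ n → Avoiders n π HasCardinality a n) × PRecursive a

private
  ∈⋃ : ∀ {n} {x : Fin n} {bs} → Any (x ∈_) bs → x ∈ ⋃ bs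
  ∈⋃ {bs = b ∷ bs} (here x∈b)  = p⊆p∪q (⋃ bs) x∈b
  ∈⋃ {bs = b ∷ bs} (there x∈)  = q⊆p∪q b (⋃ bs) (∈⋃ x∈)

  cover-⊤ : ∀ {n} {bs : List (Subset n)} → (∀ x → Any (x ∈_) bs) → ⋃ bs ≡ ⊤
  cover-⊤ f = ⊆-antisym ⊆⊤ (λ {x} _ → ∈⋃ (f x))

  disjoint-⁅⁆ : ∀ {n} {i j : Fin n} → i ≢ j → Disjoint ⁅ i ⁆ ⁅ j ⁆
  disjoint-⁅⁆ {i = i} {j} i≢j (x , x∈) with x∈p∩q⁻ ⁅ i ⁆ ⁅ j ⁆ x∈
  ... | x∈i , x∈j = i≢j (trans (sym (x∈⁅y⁆⇒x≡y i x∈i)) (x∈⁅y⁆⇒x≡y j x∈j))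

singletons : ∀ m → Partition m
singletons m = record
  { blocks   = tabulate ⁅_⁆
  ; nonempty = All.tabulate⁺ (λ i → i , x∈⁅x⁆ i)
  ; disjoint = AllPairs.tabulate⁺ disjoint-⁅⁆
  ; cover    = cover-⊤ (λ x → Any.tabulate⁺ x (x∈⁅x⁆ x))
  }

oneBlock : ∀ m → 1 ℕ.≤ m → Partition m
oneBlock (suc m) _ = record
  { blocks   = ⊤ ∷ []
  ; nonempty = (zero , ∈⊤) ∷ []
  ; disjoint = [] ∷ []
  ; cover    = cover-⊤ {bs = ⊤ ∷ []} (λ x → here ∈⊤)
  }

pairAndSingletons : ∀ m → 2 ℕ.≤ m → Partition m
pairAndSingletons 1 (s≤s ())
pairAndSingletons (suc (suc m)) _ = record
  { blocks   = pair ∷ tabulate single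
  ; nonempty = (zero , here) ∷ All.tabulate⁺ (λ i → _ , x∈⁅x⁆ (suc (suc i)))
  ; disjoint = All.tabulate⁺ pair-disjoint
             ∷ AllPairs.tabulate⁺ (λ {i} {j} i≢j →
                 disjoint-⁅⁆ {i = suc (suc i)} {suc (suc j)} λ { refl → i≢j refl })
  ; cover    = cover-⊤ {bs = pair ∷ tabulate single} λ where
      zero          → here here
      (suc zero)    → here (there here)
      (suc (suc x)) → there (Any.tabulate⁺ x (x∈⁅x⁆ (suc (suc x))))
  }
  where
  pair : Subset (suc (suc m))
  pair = ⁅ zero ⁆ ∪ ⁅ suc zero ⁆

  single : Fin m → Subset (suc (suc m))
  single i = ⁅ suc (suc i) ⁆

  pair-disjoint : ∀ i → Disjoint pair (single i)
  pair-disjoint i (x , x∈) with x∈p∩q⁻ pair (single i) x∈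
  ... | x∈pair , x∈i with x∈⁅y⁆⇒x≡y (suc (suc i)) x∈i | x∈p∪q⁻ ⁅ zero ⁆ ⁅ suc zero ⁆ x∈pair
  ... | refl | inj₁ x∈0 = contradiction (x∈⁅y⁆⇒x≡y zero x∈0) λ ()
  ... | refl | inj₂ x∈1 = contradiction (x∈⁅y⁆⇒x≡y (suc zero) x∈1) λ ()

{-# OPTIONS --safe #-}

-- Read from its largest element to its smallest, a partition becomes a
-- restricted growth word, and it contains π exactly when the word has a subword
-- with the equality pattern of π.  Adding a new smallest element turns counting
-- into iterating the transfer operator F ↦ (w ↦ Σ_c F (c ∷ w)) on statistics of
-- words.  For 1/2/…/m, 12/3/…/m, 1/23 and 13/2 the avoiders are the words
-- reaching certain states of a finite triangular system (for 12/3/…/m a state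
-- records how many blocks may still be joined), so the counts are killed by a
-- product of operators E − c, with E the shift.  For 12…m, splitting off the
-- block of the largest element gives
--   a (n + 1) = Σ_{i < m − 1} C(n, i) a (n − i),
-- whose coefficients become integer polynomials after multiplication by (m − 1)!.

module Submission where

open import Defs
open import Algebra.Properties.Monoid.Sum using (sum)
open import Data.Bool.Base using (Bool; true; false; T; if_then_else_; _∧_; _∨_)
open import Data.Bool.Properties using (T?; ∧-zeroʳ; ∧-identityʳ; ∨-zeroʳ; ∨-identityʳ)
open import Data.Fin.Base as Fin using (Fin; zero; suc; toℕ; fromℕ<)
import Data.Fin.Properties as Fin
open import Data.Fin.Subset using (Subset; _∈_; ⋃; _∪_; ∣_∣; ⁅_⁆; Nonempty)
open import Data.Fin.Subset.Properties
  using (_∈?_; ∉⊥; x∈p∩q⁺; x∈p∩q⁻; x∈p∪q⁻; x∈⁅y⁆⇒x≡y; ∈⊤; ⊆-antisym; ⊆⊤; p⊆p∪q; q⊆p∪q)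
open import Data.Integer.Base as ℤ using (ℤ; +_; 0ℤ; 1ℤ; -1ℤ)
import Data.Integer.Properties as ℤ
open import Data.Integer.Tactic.RingSolver using (solve-∀)
open import Data.List.Base as List using (List; []; _∷_; _++_; length)
open import Data.List.Membership.Propositional using (find) renaming (_∈_ to _∈ˡ_)
open import Data.List.Membership.Propositional.Properties
  using (∈-lookup; ∈-downFrom⁺; ∈-downFrom⁻; ∈-map⁺; ∈-map⁻; ∈-concatMap⁺; ∈-concatMap⁻;
         ∈-filter⁺; ∈-filter⁻)
open import Data.List.Membership.Propositional.Properties.WithK using (unique∧set⇒bag)
import Data.List.Properties as List
open import Data.List.Relation.Binary.BagAndSetEquality using (∼bag⇒↭)
open import Data.List.Relation.Binary.Permutation.Propositional using (_↭_; ↭-sym; ↭-reflexive)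
open import Data.List.Relation.Binary.Permutation.Propositional.Properties using (Any-resp-↭)
open import Data.List.Relation.Unary.All as All using (All; []; _∷_)
import Data.List.Relation.Unary.All.Properties as All
open import Data.List.Relation.Unary.AllPairs as AllPairs using (AllPairs; []; _∷_)
import Data.List.Relation.Unary.AllPairs.Properties as AllPairs
open import Data.List.Relation.Unary.Any as Any using (Any; here; there; index)
import Data.List.Relation.Unary.Any.Properties as Any
open import Data.List.Relation.Unary.Unique.Propositional using (Unique)
import Data.List.Relation.Unary.Unique.Propositional.Properties as Unique
open import Data.Nat.Base as ℕ
  using (ℕ; zero; suc; _≤_; _<_; _⊔_; _∸_; _!; _≡ᵇ_; _<ᵇ_; z≤n; s≤s)
open import Data.Nat.Combinatorics
  using (_C_; nCn≡1; nCk≡nC[n∸k]; nC1≡n; k>n⇒nCk≡0; nCk+nC[k+1]≡[n+1]C[k+1])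
open import Data.Nat.Divisibility using (divides; m≤n⇒m!∣n!)
open import Data.Nat.Properties as ℕ
open import Data.Nat.Tactic.RingSolver using () renaming (solve-∀ to solveℕ-∀)
open import Data.Product.Base using (Σ; ∃; ∃₂; _×_; _,_; proj₁; proj₂)
open import Data.Sum.Base using (inj₁; inj₂)
open import Data.Vec.Base as Vec using (Vec; []; _∷_; lookup; here; there)
import Data.Vec.Properties as Vec
open import Data.Vec.Relation.Unary.All as Allᵛ using ([]; _∷_) renaming (All to Allᵛ)
import Data.Vec.Relation.Unary.All.Properties as Allᵛ
open import Data.Vec.Relation.Unary.AllPairs using ([]; _∷_)
open import Data.Vec.Relation.Unary.Unique.Propositional using () renaming (Unique to Distinct)
import Data.Vec.Relation.Unary.Unique.Propositional.Properties as Distinct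
open import Function.Base using (_∘_)
open import Function.Bundles using (_⇔_; mk⇔; Equivalence)
open import Function.Definitions using (Injective)
open import Level using (0ℓ)
open import Relation.Binary.Bundles using (Setoid)
open import Relation.Binary.Core using (Rel)
open import Relation.Binary.Definitions as Binary using (tri<; tri≈; tri>)
open import Relation.Binary.PropositionalEquality
open import Relation.Binary.Structures using (IsEquivalence)
open import Relation.Nullary using (¬_; yes; no; contradiction)
open import Relation.Nullary.Decidable using (_×-dec_; does)

open Equivalence using (to; from)

-- Partitions as restricted growth words

-- Both equality of partitions and containment depend only on the relation of lying in a common
-- block, so everything passes through `SameBlock` and lists of blocks disappear early. Words grow
-- at the head, the smallest element, while labels are assigned from the tail; a new element
-- therefore never renumbers old blocks, and its choices are the `nb w` old letters and one fresh
-- letter. For 12/3/.../m this end is also the useful one: the pair of the pattern sits at its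
-- smallest positions, so an occurrence that uses the new element uses it in the pair, and whether
-- one arises depends only on the word already read. The pattern 12...m resists such a system: for m
-- = 3 its avoiders are counted by the involution numbers, which outgrow every exponential, so no
-- recurrence with constant coefficients can exist. There block sizes replace words, and the
-- polynomial coefficients come from choosing the companions of the largest element.

SameBlock : ∀ {n} → List (Subset n) → Rel (Fin n) 0ℓ
SameBlock bs x y = Any (λ B → x ∈ B × y ∈ B) bs

sameBlock? : ∀ {n} (bs : List (Subset n)) → Binary.Decidable (SameBlock bs)
sameBlock? bs x y = Any.any? (λ B → (x ∈? B) ×-dec (y ∈? B)) bs

disjoint-index : ∀ {n} {bs : List (Subset n)} {x} → AllPairs Disjoint bs → ∀ i j →
                 x ∈ List.lookup bs i → x ∈ List.lookup bs j → i ≡ j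
disjoint-index         (d ∷ ds) zero    zero    p q = refl
disjoint-index {x = x} (d ∷ ds) zero    (suc j) p q =
  contradiction (x , x∈p∩q⁺ (p , q)) (All.lookup d (∈-lookup j))
disjoint-index {x = x} (d ∷ ds) (suc i) zero    p q =
  contradiction (x , x∈p∩q⁺ (q , p)) (All.lookup d (∈-lookup i))
disjoint-index         (d ∷ ds) (suc i) (suc j) p q = cong suc (disjoint-index ds i j p q)

sameBlock-index : ∀ {n} {bs : List (Subset n)} {x y} → SameBlock bs x y →
                  ∃ λ i → x ∈ List.lookup bs i × y ∈ List.lookup bs i
sameBlock-index p = index p , Any.lookup-index p

index-sameBlock : ∀ {n} (bs : List (Subset n)) {x y} i →
                  x ∈ List.lookup bs i → y ∈ List.lookup bs i → SameBlock bs x y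
index-sameBlock (B ∷ bs) zero    p q = here (p , q)
index-sameBlock (B ∷ bs) (suc i) p q = there (index-sameBlock bs i p q)

sameBlock-sym : ∀ {n} {bs : List (Subset n)} {x y} → SameBlock bs x y → SameBlock bs y x
sameBlock-sym = Any.map λ (p , q) → q , p

sameBlock-trans : ∀ {n} {bs : List (Subset n)} {x y z} → AllPairs Disjoint bs →
                  SameBlock bs x y → SameBlock bs y z → SameBlock bs x z
sameBlock-trans {bs = bs} ds p q with sameBlock-index p | sameBlock-index q
... | i , x∈ , y∈ | j , y∈′ , z∈ with disjoint-index ds i j y∈ y∈′
...   | refl = index-sameBlock bs i x∈ z∈

∈⋃⇒Any : ∀ {n} {bs : List (Subset n)} {x} → x ∈ ⋃ bs → Any (x ∈_) bs
∈⋃⇒Any {bs = []}     x∈ = contradiction x∈ ∉⊥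
∈⋃⇒Any {bs = B ∷ bs} x∈ with x∈p∪q⁻ B (⋃ bs) x∈
... | inj₁ x∈B  = here x∈B
... | inj₂ x∈bs = there (∈⋃⇒Any x∈bs)

Any⇒∈⋃ : ∀ {n} {bs : List (Subset n)} {x} → Any (x ∈_) bs → x ∈ ⋃ bs
Any⇒∈⋃ {bs = B ∷ bs} (here x∈)  = p⊆p∪q (⋃ bs) x∈
Any⇒∈⋃ {bs = B ∷ bs} (there x∈) = q⊆p∪q B (⋃ bs) (Any⇒∈⋃ x∈)

sameBlock-refl : ∀ {n} {S : Subset n} (σ : PartitionOf S) {x} → x ∈ S →
                 SameBlock (blocks σ) x x
sameBlock-refl σ x∈S = Any.map (λ p → p , p) (∈⋃⇒Any (subst (_ ∈_) (sym (cover σ)) x∈S))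

sameBlock-isEquivalence : ∀ {n} (σ : Partition n) → IsEquivalence (SameBlock (blocks σ))
sameBlock-isEquivalence σ = record
  { refl  = sameBlock-refl σ ∈⊤
  ; sym   = sameBlock-sym
  ; trans = sameBlock-trans (disjoint σ)
  }

blocks-unique : ∀ {n} {bs : List (Subset n)} → All Nonempty bs → AllPairs Disjoint bs → Unique bs
blocks-unique []       []       = []
blocks-unique ((x , x∈B) ∷ ne) (d ∷ ds) =
  All.map (λ { dj refl → dj (x , x∈p∩q⁺ (x∈B , x∈B)) }) d ∷ blocks-unique ne ds

-- A block is the whole class of any point in it. Nonemptiness supplies a point x of B, and the
-- block of `cs` through x has the same elements because the two relations agree.
sameBlock-⊆ : ∀ {n} {bs cs : List (Subset n)} →
              All Nonempty bs → AllPairs Disjoint bs → AllPairs Disjoint cs →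
              (∀ x y → SameBlock bs x y ⇔ SameBlock cs x y) →
              ∀ {B} → B ∈ˡ bs → B ∈ˡ cs
sameBlock-⊆ {bs = bs} {cs} ne dbs dcs e {B} B∈
  with All.lookup ne B∈
... | x , x∈B with sameBlock-index (to (e x x) (in-bs x∈B x∈B))
  where
  in-bs : ∀ {x y} → x ∈ B → y ∈ B → SameBlock bs x y
  in-bs p q = Any.map (λ { refl → p , q }) B∈
...   | j , x∈C , _ = subst (_∈ˡ cs) (⊆-antisym C⊆B B⊆C) (∈-lookup j)
  where
  i = index B∈
  B≡ : B ≡ List.lookup bs i
  B≡ = Any.lookup-index B∈
  B⊆C : ∀ {y} → y ∈ B → y ∈ List.lookup cs j
  B⊆C {y} y∈B with sameBlock-index (to (e x y) (Any.map (λ { refl → x∈B , y∈B }) B∈))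
  ... | j′ , x∈C′ , y∈C′ with disjoint-index dcs j j′ x∈C x∈C′
  ...   | refl = y∈C′
  C⊆B : ∀ {y} → y ∈ List.lookup cs j → y ∈ B
  C⊆B {y} y∈C with sameBlock-index (from (e x y) (index-sameBlock cs j x∈C y∈C))
  ... | i′ , x∈B′ , y∈B′ with disjoint-index dbs i i′ (subst (x ∈_) B≡ x∈B) x∈B′
  ...   | refl = subst (y ∈_) (sym B≡) y∈B′

-- Neither list repeats a block, so having the same members already makes one a rearrangement of the
-- other.
sameBlock⇒↭ : ∀ {n} {bs cs : List (Subset n)} →
              All Nonempty bs → AllPairs Disjoint bs →
              All Nonempty cs → AllPairs Disjoint cs →
              (∀ x y → SameBlock bs x y ⇔ SameBlock cs x y) → bs ↭ cs
sameBlock⇒↭ nbs dbs ncs dcs e =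
  ∼bag⇒↭ (unique∧set⇒bag (blocks-unique nbs dbs) (blocks-unique ncs dcs)
    (mk⇔ (sameBlock-⊆ nbs dbs dcs e)
         (sameBlock-⊆ ncs dcs dbs (λ x y → mk⇔ (from (e x y)) (to (e x y))))))

↭⇒sameBlock : ∀ {n} {bs cs : List (Subset n)} → bs ↭ cs →
              ∀ x y → SameBlock bs x y ⇔ SameBlock cs x y
↭⇒sameBlock p x y = mk⇔ (Any-resp-↭ p) (Any-resp-↭ (↭-sym p))

-- The position of an element in w is the element itself and its letter is the
-- label of its block; blocks are numbered as they appear when the elements are
-- read from the largest to the smallest.

nb : ∀ {n} → Vec ℕ n → ℕ
nb []      = 0
nb (c ∷ w) = suc c ⊔ nb w

data RGF : ∀ {n} → Vec ℕ n → Set where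
  []  : RGF []
  _∷_ : ∀ {n c} {w : Vec ℕ n} → c ≤ nb w → RGF w → RGF (c ∷ w)

nb-old : ∀ {n c} {w : Vec ℕ n} → c < nb w → nb (c ∷ w) ≡ nb w
nb-old = m≤n⇒m⊔n≡n

nb-new : ∀ {n} (w : Vec ℕ n) → nb (nb w ∷ w) ≡ suc (nb w)
nb-new w = m≥n⇒m⊔n≡m (n≤1+n (nb w))

lookup<nb : ∀ {n} (w : Vec ℕ n) x → lookup w x < nb w
lookup<nb (c ∷ w) zero    = m≤m⊔n (suc c) (nb w)
lookup<nb (c ∷ w) (suc x) = m≤n⇒m≤o⊔n (suc c) (lookup<nb w x)

RGF-surjective : ∀ {n} {w : Vec ℕ n} → RGF w → ∀ {b} → b < nb w → ∃ λ x → lookup w x ≡ b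
RGF-surjective {w = c ∷ w} (c≤ ∷ r) {b} b< with b ℕ.≟ c
... | yes refl = zero , refl
... | no b≢c with m≤n⇒m<n∨m≡n c≤
...   | inj₁ c< with RGF-surjective r (subst (b <_) (nb-old {w = w} c<) b<)
...     | x , eq = suc x , eq
RGF-surjective {w = c ∷ w} (c≤ ∷ r) {b} b< | no b≢c | inj₂ refl
  with RGF-surjective r (≤∧≢⇒< (≤-pred (subst (b <_) (nb-new w) b<)) b≢c)
... | x , eq = suc x , eq

Ker : ∀ {n} → Vec ℕ n → Rel (Fin n) 0ℓ
Ker w x y = lookup w x ≡ lookup w y

-- The tails agree by induction. A head letter below `nb` recurs in the tail, where the kernel
-- forces the other head to equal it; if neither head is old, both are the fresh letter.
Ker-injective : ∀ {n} {v w : Vec ℕ n} → RGF v → RGF w → (∀ x y → Ker v x y ⇔ Ker w x y) → v ≡ w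
Ker-injective []       []       e = refl
Ker-injective {v = c ∷ v} {d ∷ w} (c≤ ∷ rv) (d≤ ∷ rw) e
  with Ker-injective rv rw (λ x y → e (suc x) (suc y))
... | refl with m≤n⇒m<n∨m≡n c≤ | m≤n⇒m<n∨m≡n d≤
...   | inj₁ c<   | _ with RGF-surjective rv c<
...     | x , eq = cong (_∷ v) (sym (trans (to (e zero (suc x)) (sym eq)) eq))
Ker-injective (_ ∷ rv) _ e | refl | inj₂ refl | inj₁ d< with RGF-surjective rv d<
...   | x , eq = cong (_∷ _) (trans (from (e zero (suc x)) (sym eq)) eq)
Ker-injective _ _ e | refl | inj₂ refl | inj₂ refl = refl

-- Decidability serves to ask whether the new smallest element is related to a later one: its letter
-- is copied from such an element, and otherwise it is the fresh letter.
Ker-surjective : ∀ {n} (E : Rel (Fin n) 0ℓ) → Binary.Decidable E → IsEquivalence E →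
                 ∃ λ w → RGF w × (∀ x y → E x y ⇔ Ker w x y)
Ker-surjective {zero}  E E? eqv = [] , [] , λ ()
Ker-surjective {suc n} E E? eqv
  with Ker-surjective (λ x y → E (suc x) (suc y)) (λ x y → E? (suc x) (suc y))
         (record { refl = E.refl ; sym = E.sym ; trans = E.trans })
     | Fin.any? (λ y → E? zero (suc y))
  where module E = IsEquivalence eqv
... | w , r , e | yes (y , 0∼y) = lookup w y ∷ w , <⇒≤ (lookup<nb w y) ∷ r , λ where
        zero    zero    → mk⇔ (λ _ → refl) (λ _ → E.refl)
        zero    (suc z) → mk⇔ (λ 0∼z → to (e y z) (E.trans (E.sym 0∼y) 0∼z))
                              (λ eq → E.trans 0∼y (from (e y z) eq))
        (suc x) zero    → mk⇔ (λ x∼0 → to (e x y) (E.trans x∼0 0∼y))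
                              (λ eq → E.trans (from (e x y) eq) (E.sym 0∼y))
        (suc x) (suc z) → e x z
  where module E = IsEquivalence eqv
... | w , r , e | no ¬0∼ = nb w ∷ w , ≤-refl ∷ r , λ where
        zero    zero    → mk⇔ (λ _ → refl) (λ _ → E.refl)
        zero    (suc z) → mk⇔ (λ 0∼z → contradiction (z , 0∼z) ¬0∼)
                              (λ eq → contradiction (sym eq) (<⇒≢ (lookup<nb w z)))
        (suc x) zero    → mk⇔ (λ x∼0 → contradiction (x , E.sym x∼0) ¬0∼)
                              (λ eq → contradiction eq (<⇒≢ (lookup<nb w x)))
        (suc x) (suc z) → e x z
  where module E = IsEquivalence eqv

fibre : ∀ {n} → Vec ℕ n → ℕ → Subset n
fibre w b = Vec.map (λ c → does (c ℕ.≟ b)) w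

∈-fibre⁺ : ∀ {n} (w : Vec ℕ n) {b x} → lookup w x ≡ b → x ∈ fibre w b
∈-fibre⁺ w {b} {x} eq with lookup w x ℕ.≟ b in d
... | yes _ = Vec.lookup⇒[]= x (fibre w b) (trans (Vec.lookup-map x _ w) (cong does d))
... | no ≢b = contradiction eq ≢b

∈-fibre⁻ : ∀ {n} (w : Vec ℕ n) {b x} → x ∈ fibre w b → lookup w x ≡ b
∈-fibre⁻ w {b} {x} x∈ with lookup w x ℕ.≟ b in d
... | yes eq = eq
... | no _ with trans (sym (Vec.[]=⇒lookup x∈)) (trans (Vec.lookup-map x _ w) (cong does d))
...   | ()

fibres : ∀ {n} → Vec ℕ n → List (Subset n)
fibres w = List.map (fibre w) (List.downFrom (nb w))

sameBlock-fibres : ∀ {n} (w : Vec ℕ n) x y → SameBlock (fibres w) x y ⇔ Ker w x y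
sameBlock-fibres w x y = mk⇔ f g
  where
  f : SameBlock (fibres w) x y → Ker w x y
  f p with Any.satisfied (Any.map⁻ p)
  ... | b , x∈ , y∈ = trans (∈-fibre⁻ w x∈) (sym (∈-fibre⁻ w y∈))
  g : Ker w x y → SameBlock (fibres w) x y
  g eq = Any.map⁺ (Any.map (λ { refl → ∈-fibre⁺ w refl , ∈-fibre⁺ w (sym eq) })
                           (∈-downFrom⁺ (lookup<nb w x)))

toPartition : ∀ {n} {w : Vec ℕ n} → RGF w → Partition n
toPartition {w = w} r = record
  { blocks   = fibres w
  ; nonempty = All.map⁺ (All.applyDownFrom⁺₁ _ (nb w) λ b< →
                 let x , eq = RGF-surjective r b< in x , ∈-fibre⁺ w eq)
  ; disjoint = AllPairs.map⁺ (AllPairs.map (λ b≢c (x , x∈) →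
                 let p , q = x∈p∩q⁻ (fibre w _) _ x∈
                 in b≢c (trans (sym (∈-fibre⁻ w p)) (∈-fibre⁻ w q))) (Unique.downFrom⁺ (nb w)))
  ; cover    = ⊆-antisym ⊆⊤ λ {x} _ →
                 Any⇒∈⋃ (Any.map proj₁ (from (sameBlock-fibres w x x) refl))
  }

wordOf : ∀ {n} (σ : Partition n) →
         ∃ λ w → RGF w × (∀ x y → SameBlock (blocks σ) x y ⇔ Ker w x y)
wordOf σ = Ker-surjective _ (sameBlock? (blocks σ)) (sameBlock-isEquivalence σ)

word : ∀ {n} → Partition n → Vec ℕ n
word σ = proj₁ (wordOf σ)

word-RGF : ∀ {n} (σ : Partition n) → RGF (word σ)
word-RGF σ = proj₁ (proj₂ (wordOf σ))

word-Ker : ∀ {n} (σ : Partition n) x y → SameBlock (blocks σ) x y ⇔ Ker (word σ) x y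
word-Ker σ = proj₂ (proj₂ (wordOf σ))

word-cong : ∀ {n} (σ τ : Partition n) → σ ≈ᵖ τ → word σ ≡ word τ
word-cong σ τ σ≈τ = Ker-injective (word-RGF σ) (word-RGF τ) λ x y → mk⇔
  (to (word-Ker τ x y) ∘ to (↭⇒sameBlock σ≈τ x y) ∘ from (word-Ker σ x y))
  (to (word-Ker σ x y) ∘ from (↭⇒sameBlock σ≈τ x y) ∘ from (word-Ker τ x y))

word-injective : ∀ {n} (σ τ : Partition n) → word σ ≡ word τ → σ ≈ᵖ τ
word-injective σ τ eq = sameBlock⇒↭ (nonempty σ) (disjoint σ) (nonempty τ) (disjoint τ) λ x y → mk⇔
  (from (word-Ker τ x y) ∘ subst (λ w → Ker w x y) eq ∘ to (word-Ker σ x y))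
  (from (word-Ker σ x y) ∘ subst (λ w → Ker w x y) (sym eq) ∘ to (word-Ker τ x y))

word-toPartition : ∀ {n} {w : Vec ℕ n} (r : RGF w) → word (toPartition r) ≡ w
word-toPartition {w = w} r = Ker-injective (word-RGF (toPartition r)) r λ x y → mk⇔
  (to (sameBlock-fibres w x y) ∘ from (word-Ker (toPartition r) x y))
  (to (word-Ker (toPartition r) x y) ∘ from (sameBlock-fibres w x y))

-- Pattern containment in terms of subwords

-- The inverse of `st`. Addressing the elements of S by their rank avoids carrying membership
-- proofs.
enum : ∀ {n} (S : Subset n) → Fin ∣ S ∣ → Fin n
enum (true  ∷ S) zero    = zero
enum (true  ∷ S) (suc k) = suc (enum S k)
enum (false ∷ S) k       = suc (enum S k)

enum-surjective : ∀ {n} (S : Subset n) {x} → x ∈ S → ∃ λ k → enum S k ≡ x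
enum-surjective (true ∷ S) here = zero , refl
enum-surjective (true ∷ S) (there x∈) with enum-surjective S x∈
... | k , refl = suc k , refl
enum-surjective (false ∷ S) (there x∈) with enum-surjective S x∈
... | k , refl = k , refl

enum-∈ : ∀ {n} (S : Subset n) k → enum S k ∈ S
enum-∈ (true  ∷ S) zero    = here
enum-∈ (true  ∷ S) (suc k) = there (enum-∈ S k)
enum-∈ (false ∷ S) k       = there (enum-∈ S k)

∈-stBlock : ∀ {n} (S B : Subset n) k → (k ∈ stBlock S B) ⇔ (enum S k ∈ B)
∈-stBlock S B k = mk⇔ (λ k∈ → Vec.lookup⇒[]= _ B (trans (sym (eq S B k)) (Vec.[]=⇒lookup k∈)))
                      (λ x∈ → Vec.lookup⇒[]= _ _ (trans (eq S B k) (Vec.[]=⇒lookup x∈)))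
  where
  eq : ∀ {n} (S B : Subset n) k → lookup (stBlock S B) k ≡ lookup B (enum S k)
  eq (true  ∷ S) (b ∷ B) zero    = refl
  eq (true  ∷ S) (b ∷ B) (suc k) = eq S B k
  eq (false ∷ S) (b ∷ B) k       = eq S B k

sameBlock-stBlock : ∀ {n} (S : Subset n) bs i j →
  SameBlock (List.map (stBlock S) bs) i j ⇔ SameBlock bs (enum S i) (enum S j)
sameBlock-stBlock S bs i j = mk⇔
  (Any.map (λ {B} (p , q) → to (∈-stBlock S B i) p , to (∈-stBlock S B j) q) ∘ Any.map⁻)
  (Any.map⁺ ∘ Any.map (λ {B} (p , q) → from (∈-stBlock S B i) p , from (∈-stBlock S B j) q))

unstBlock : ∀ {n} (S : Subset n) → Subset ∣ S ∣ → Subset n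
unstBlock []          B       = []
unstBlock (true  ∷ S) (b ∷ B) = b ∷ unstBlock S B
unstBlock (false ∷ S) B       = false ∷ unstBlock S B

stBlock-unstBlock : ∀ {n} (S : Subset n) B → stBlock S (unstBlock S B) ≡ B
stBlock-unstBlock []          []      = refl
stBlock-unstBlock (true  ∷ S) (b ∷ B) = cong (b ∷_) (stBlock-unstBlock S B)
stBlock-unstBlock (false ∷ S) B       = stBlock-unstBlock S B

∈-unstBlock : ∀ {n} (S : Subset n) B k → (enum S k ∈ unstBlock S B) ⇔ (k ∈ B)
∈-unstBlock S B k = mk⇔
  (λ p → subst (k ∈_) (stBlock-unstBlock S B) (from (∈-stBlock S (unstBlock S B) k) p))
  (λ p → to (∈-stBlock S (unstBlock S B) k) (subst (k ∈_) (sym (stBlock-unstBlock S B)) p))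

unstBlock⊆ : ∀ {n} (S : Subset n) B {x} → x ∈ unstBlock S B → x ∈ S
unstBlock⊆ (true  ∷ S) (_ ∷ B) here      = here
unstBlock⊆ (true  ∷ S) (_ ∷ B) (there p) = there (unstBlock⊆ S B p)
unstBlock⊆ (false ∷ S) B       (there p) = there (unstBlock⊆ S B p)

unst : ∀ {n} (S : Subset n) → Partition ∣ S ∣ → PartitionOf S
unst S π = record
  { blocks   = List.map (unstBlock S) (blocks π)
  ; nonempty = All.map⁺ (All.map (λ {B} (k , k∈) → enum S k , from (∈-unstBlock S B k) k∈) (nonempty π))
  ; disjoint = AllPairs.map⁺ (AllPairs.map (λ {B} {B′} → disj {B} {B′}) (disjoint π))
  ; cover    = ⊆-antisym ⊆S S⊆
  }
  where
  disj : ∀ {B B′} → Disjoint B B′ → Disjoint (unstBlock S B) (unstBlock S B′)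
  disj {B} {B′} d (x , x∈) with x∈p∩q⁻ (unstBlock S B) _ x∈
  ... | p , q with enum-surjective S (unstBlock⊆ S B p)
  ...   | k , refl = d (k , x∈p∩q⁺ (to (∈-unstBlock S B k) p , to (∈-unstBlock S B′ k) q))
  ⊆S : ∀ {x} → x ∈ ⋃ (List.map (unstBlock S) (blocks π)) → x ∈ S
  ⊆S x∈ with Any.satisfied (Any.map⁻ (∈⋃⇒Any {bs = List.map (unstBlock S) (blocks π)} x∈))
  ... | B , p = unstBlock⊆ S B p
  S⊆ : ∀ {x} → x ∈ S → x ∈ ⋃ (List.map (unstBlock S) (blocks π))
  S⊆ x∈ with enum-surjective S x∈
  ... | k , refl = Any⇒∈⋃ (Any.map⁺ (Any.map (λ {B} (p , _) → from (∈-unstBlock S B k) p)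
                                             (sameBlock-refl π {k} ∈⊤)))

sameBlock-unst : ∀ {n} (S : Subset n) (π : Partition ∣ S ∣) i j →
  SameBlock (blocks (unst S π)) (enum S i) (enum S j) ⇔ SameBlock (blocks π) i j
sameBlock-unst S π i j = mk⇔
  (Any.map (λ {B} (p , q) → to (∈-unstBlock S B i) p , to (∈-unstBlock S B j) q) ∘ Any.map⁻)
  (Any.map⁺ ∘ Any.map (λ {B} (p , q) → from (∈-unstBlock S B i) p , from (∈-unstBlock S B j) q))

-- Containment with a fixed support S, as agreement of two relations on `Fin ∣ S ∣`; the
-- subpartition and its map between block positions are gone.
_ContainsAt_ : ∀ {n} (σ : Partition n) {S : Subset n} → Partition ∣ S ∣ → Set
_ContainsAt_ σ {S} π =
  ∀ i j → SameBlock (blocks σ) (enum S i) (enum S j) ⇔ SameBlock (blocks π) i j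

subpartition⇒containsAt : ∀ {n} (σ : Partition n) {S} (σ′ : PartitionOf S) (π : Partition ∣ S ∣) →
  σ′ IsSubpartitionOf σ → stBlocks σ′ ↭ blocks π → σ ContainsAt π
subpartition⇒containsAt σ {S} σ′ π (f , f-inj , f-⊆) p i j = mk⇔
  (to (↭⇒sameBlock p i j) ∘ from (sameBlock-stBlock S (blocks σ′) i j) ∘ down)
  (up ∘ to (sameBlock-stBlock S (blocks σ′) i j) ∘ from (↭⇒sameBlock p i j))
  where
  up : ∀ {x y} → SameBlock (blocks σ′) x y → SameBlock (blocks σ) x y
  up q with sameBlock-index q
  ... | a , x∈ , y∈ = index-sameBlock (blocks σ) (f a) (f-⊆ a x∈) (f-⊆ a y∈)
  -- Injectivity of f enters here: the blocks of σ′ through the two points are both sent to the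
  -- block c of σ, hence they coincide.
  down : SameBlock (blocks σ) (enum S i) (enum S j) → SameBlock (blocks σ′) (enum S i) (enum S j)
  down q with sameBlock-index q
            | sameBlock-index (sameBlock-refl σ′ (enum-∈ S i))
            | sameBlock-index (sameBlock-refl σ′ (enum-∈ S j))
  ... | c , x∈ , y∈ | a , x∈a , _ | b , y∈b , _
    with f-inj (trans (disjoint-index (disjoint σ) (f a) c (f-⊆ a x∈a) x∈)
                      (disjoint-index (disjoint σ) c (f b) y∈ (f-⊆ b y∈b)))
  ...   | refl = index-sameBlock (blocks σ′) a x∈a y∈b

-- A block of `unst S π` goes to the block of σ through a chosen point of it. If two images agree, σ
-- relates the chosen points, hence so does π, and the blocks are equal (`meet`); conversely points
-- related by π are related by σ, which gives the inclusion (`follow`).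
containsAt⇒subpartition : ∀ {n} (σ : Partition n) {S : Subset n} (π : Partition ∣ S ∣) →
  σ ContainsAt π → unst S π IsSubpartitionOf σ
containsAt⇒subpartition σ {S} π e = f , f-inj , f-⊆
  where
  ρ = unst S π
  witness : ∀ a → Nonempty (List.lookup (blocks ρ) a)
  witness a = All.lookup (nonempty ρ) (∈-lookup a)
  home : ∀ a → ∃ λ c → proj₁ (witness a) ∈ List.lookup (blocks σ) c
  home a with sameBlock-index (sameBlock-refl σ {proj₁ (witness a)} ∈⊤)
  ... | c , x∈ , _ = c , x∈
  inS : ∀ a {x} → x ∈ List.lookup (blocks ρ) a → x ∈ S
  inS a x∈ = subst (_ ∈_) (cover ρ) (Any⇒∈⋃ (Any.map proj₁ (index-sameBlock (blocks ρ) a x∈ x∈)))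
  f : Fin (length (blocks ρ)) → Fin (length (blocks σ))
  f a = proj₁ (home a)
  meet : ∀ {a b c x y} → x ∈ List.lookup (blocks ρ) a → x ∈ List.lookup (blocks σ) c →
         y ∈ List.lookup (blocks ρ) b → y ∈ List.lookup (blocks σ) c → a ≡ b
  meet {a} {b} {c} x∈a x∈c y∈b y∈c
    with enum-surjective S (inS a x∈a) | enum-surjective S (inS b y∈b)
  ... | i , refl | j , refl
    with sameBlock-index (from (sameBlock-unst S π i j)
                          (to (e i j) (index-sameBlock (blocks σ) c x∈c y∈c)))
  ...   | a′ , p , q = trans (disjoint-index (disjoint ρ) a a′ x∈a p)
                             (disjoint-index (disjoint ρ) a′ b q y∈b)
  f-inj : Injective _≡_ _≡_ f
  f-inj {a} {b} fa≡fb = meet (proj₂ (witness a)) (proj₂ (home a)) (proj₂ (witness b))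
    (subst (λ c → _ ∈ List.lookup (blocks σ) c) (sym fa≡fb) (proj₂ (home b)))
  follow : ∀ {a c x y} → x ∈ List.lookup (blocks ρ) a → x ∈ List.lookup (blocks σ) c →
           y ∈ List.lookup (blocks ρ) a → y ∈ List.lookup (blocks σ) c
  follow {a} {c} x∈a x∈c y∈a
    with enum-surjective S (inS a x∈a) | enum-surjective S (inS a y∈a)
  ... | i , refl | j , refl
    with sameBlock-index (from (e i j) (to (sameBlock-unst S π i j)
                                (index-sameBlock (blocks ρ) a x∈a y∈a)))
  ...   | c′ , p , q with disjoint-index (disjoint σ) c c′ x∈c p
  ...     | refl = q
  f-⊆ : ∀ a {y} → y ∈ List.lookup (blocks ρ) a → y ∈ List.lookup (blocks σ) (f a)
  f-⊆ a = follow (proj₂ (witness a)) (proj₂ (home a))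

infix 4 _⊑_

data _⊑_ : ∀ {k n} → Vec ℕ k → Vec ℕ n → Set where
  []   : [] ⊑ []
  skip : ∀ {k n c} {v : Vec ℕ k} {w : Vec ℕ n} → v ⊑ w → v ⊑ c ∷ w
  keep : ∀ {k n c} {v : Vec ℕ k} {w : Vec ℕ n} → v ⊑ w → c ∷ v ⊑ c ∷ w

subword : ∀ {n} (S : Subset n) → Vec ℕ n → Vec ℕ ∣ S ∣
subword []          []      = []
subword (true  ∷ S) (c ∷ w) = c ∷ subword S w
subword (false ∷ S) (c ∷ w) = subword S w

lookup-subword : ∀ {n} (S : Subset n) w k → lookup (subword S w) k ≡ lookup w (enum S k)
lookup-subword (true  ∷ S) (c ∷ w) zero    = refl
lookup-subword (true  ∷ S) (c ∷ w) (suc k) = lookup-subword S w k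
lookup-subword (false ∷ S) (c ∷ w) k       = lookup-subword S w k

subword-⊑ : ∀ {n} (S : Subset n) w → subword S w ⊑ w
subword-⊑ []          []      = []
subword-⊑ (true  ∷ S) (c ∷ w) = keep (subword-⊑ S w)
subword-⊑ (false ∷ S) (c ∷ w) = skip (subword-⊑ S w)

⊑-subword : ∀ {k n} {v : Vec ℕ k} {w : Vec ℕ n} → v ⊑ w →
            ∃ λ (S : Subset n) → Σ (∣ S ∣ ≡ k) λ eq → subst (Vec ℕ) eq (subword S w) ≡ v
⊑-subword []       = [] , refl , refl
⊑-subword (skip p) with ⊑-subword p
... | S , refl , refl = false ∷ S , refl , refl
⊑-subword (keep p) with ⊑-subword p
... | S , refl , refl = true ∷ S , refl , refl

_MatchedBy_ : ∀ {k} → Partition k → Vec ℕ k → Set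
π MatchedBy v = ∀ i j → Ker v i j ⇔ SameBlock (blocks π) i j

_ContainsWord_ : ∀ {k n} → Vec ℕ n → Partition k → Set
w ContainsWord π = ∃ λ v → v ⊑ w × π MatchedBy v

Ker-subword : ∀ {n} (σ : Partition n) (S : Subset n) i j →
              Ker (subword S (word σ)) i j ⇔ SameBlock (blocks σ) (enum S i) (enum S j)
Ker-subword σ S i j = mk⇔
  (λ eq → from (word-Ker σ _ _) (trans (sym (lookup-subword S w i)) (trans eq (lookup-subword S w j))))
  (λ eq → trans (lookup-subword S w i) (trans (to (word-Ker σ _ _) eq) (sym (lookup-subword S w j))))
  where w = word σ

contains⇔ : ∀ {n k} (σ : Partition n) (π : Partition k) → (σ Contains π) ⇔ (word σ ContainsWord π)
contains⇔ σ π = mk⇔ f g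
  where
  f : σ Contains π → word σ ContainsWord π
  f (S , σ′ , sub , refl , p) = subword S (word σ) , subword-⊑ S (word σ) , λ i j → mk⇔
    (to (at i j) ∘ to (Ker-subword σ S i j)) (from (Ker-subword σ S i j) ∘ from (at i j))
    where at = subpartition⇒containsAt σ σ′ π sub p
  g : word σ ContainsWord π → σ Contains π
  g (v , v⊑ , m) with ⊑-subword v⊑
  ... | S , refl , refl = S , unst S π , containsAt⇒subpartition σ π at , refl ,
      -- `stBlock S` undoes `unstBlock S` block by block, so the two lists agree without
      -- rearrangement.
      ↭-reflexive (trans (sym (List.map-∘ (blocks π)))
                         (trans (List.map-cong (stBlock-unstBlock S) (blocks π)) (List.map-id (blocks π))))
    where
    at : σ ContainsAt π
    at i j = mk⇔ (to (m i j) ∘ from (Ker-subword σ S i j)) (to (Ker-subword σ S i j) ∘ from (m i j))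

-- Enumeration of restricted growth words and the cardinality of the avoiders.

extensions : ∀ {n} → Vec ℕ n → List (Vec ℕ (suc n))
extensions w = List.map (_∷ w) (List.downFrom (suc (nb w)))

words : ∀ n → List (Vec ℕ n)
words zero    = [] ∷ []
words (suc n) = List.concatMap extensions (words n)

∈-words⁺ : ∀ {n} {w : Vec ℕ n} → RGF w → w ∈ˡ words n
∈-words⁺ []       = here refl
∈-words⁺ (c≤ ∷ r) = ∈-concatMap⁺ extensions
  (Any.map (λ { refl → ∈-map⁺ _ (∈-downFrom⁺ (s≤s c≤)) }) (∈-words⁺ r))

∈-words⁻ : ∀ {n} {w : Vec ℕ n} → w ∈ˡ words n → RGF w
∈-words⁻ {zero}  (here refl) = []
∈-words⁻ {suc n} w∈ with find (∈-concatMap⁻ extensions {xs = words n} w∈)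
... | w′ , w′∈ , w∈′ with ∈-map⁻ (_∷ w′) w∈′
...   | c , c∈ , refl = ≤-pred (∈-downFrom⁻ c∈) ∷ ∈-words⁻ w′∈

words-unique : ∀ n → Unique (words n)
words-unique zero    = [] ∷ []
words-unique (suc n) = Unique.concat⁺
  (All.map⁺ (All.universal (λ w → Unique.map⁺ Vec.∷-injectiveˡ (Unique.downFrom⁺ (suc (nb w)))) (words n)))
  (AllPairs.map⁺ (AllPairs.map
    (λ w≢w′ {v} (p , q) → w≢w′ (trans (sym (tail-of p)) (tail-of q))) (words-unique n)))
  where
  tail-of : ∀ {w v} → v ∈ˡ extensions w → Vec.tail v ≡ w
  tail-of {w} v∈ with ∈-map⁻ (_∷ w) v∈
  ... | c , _ , refl = refl

lookup-unique : ∀ {A : Set} {xs : List A} → Unique xs → ∀ i j → List.lookup xs i ≡ List.lookup xs j → i ≡ j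
lookup-unique (x∉ ∷ u) zero    zero    eq = refl
lookup-unique (x∉ ∷ u) zero    (suc j) eq = contradiction eq (All.lookup x∉ (∈-lookup j))
lookup-unique (x∉ ∷ u) (suc i) zero    eq = contradiction (sym eq) (All.lookup x∉ (∈-lookup i))
lookup-unique (x∉ ∷ u) (suc i) (suc j) eq = cong suc (lookup-unique u i j eq)

-- The normal form g turns setoid equality into propositional equality, so positions in a
-- repetition-free list of the normal forms serve as the elements of `Fin`.
enumerated : ∀ {A : Setoid 0ℓ 0ℓ} {B : Set} (g : Setoid.Carrier A → B) {xs : List B} →
  (∀ {a b} → Setoid._≈_ A a b → g a ≡ g b) → (∀ {a b} → g a ≡ g b → Setoid._≈_ A a b) →
  Unique xs → (∀ a → g a ∈ˡ xs) → (∀ {x} → x ∈ˡ xs → ∃ λ a → g a ≡ x) →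
  A HasCardinality length xs
enumerated {A} g {xs} g-cong g-inj u g∈ surj = record
  { to        = λ i → proj₁ (surj (∈-lookup i))
  ; from      = λ a → index (g∈ a)
  ; to-cong   = λ { refl → Setoid.refl A }
  ; from-cong = λ {a} {b} a≈b → lookup-unique u _ _
      (trans (sym (Any.lookup-index (g∈ a))) (trans (g-cong a≈b) (Any.lookup-index (g∈ b))))
  ; inverse   = (λ { {a} refl → g-inj (trans (proj₂ (surj (∈-lookup (index (g∈ a)))))
                                          (sym (Any.lookup-index (g∈ a)))) })
              , (λ {i} {a} a≈ → lookup-unique u _ _
                  (trans (sym (Any.lookup-index (g∈ a))) (trans (g-cong a≈) (proj₂ (surj (∈-lookup i))))))
  }

-- Phrased by the value `false` because containment is the side with a witness to construct or to
-- inspect; avoidance follows by negation.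
_Decides_ : ∀ {k} → (∀ {n} → Vec ℕ n → Bool) → Partition k → Set
good Decides π = ∀ {n} {w : Vec ℕ n} → RGF w → (good w ≡ false) ⇔ (w ContainsWord π)

avoiders-cardinality : ∀ {k} (π : Partition k) (good : ∀ {n} → Vec ℕ n → Bool) → good Decides π →
  ∀ n → Avoiders n π HasCardinality length (List.filter (T? ∘ good) (words n))
avoiders-cardinality π good d n = enumerated (word ∘ proj₁)
  (λ {a} {b} → word-cong (proj₁ a) (proj₁ b))
  (λ {a} {b} → word-injective (proj₁ a) (proj₁ b))
  (Unique.filter⁺ (T? ∘ good) (words-unique n))
  (λ (σ , av) → ∈-filter⁺ (T? ∘ good) (∈-words⁺ (word-RGF σ)) (isGood σ av))
  surj
  where
  isGood : ∀ σ → σ Avoids π → T (good (word σ))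
  isGood σ av with good (word σ) in eq
  ... | true  = _
  ... | false = contradiction (from (contains⇔ σ π) (to (d (word-RGF σ)) eq)) av
  surj : ∀ {w} → w ∈ˡ List.filter (T? ∘ good) (words n) → ∃ λ a → word (proj₁ a) ≡ w
  surj {w} w∈ with ∈-filter⁻ (T? ∘ good) {xs = words n} w∈
  ... | w∈words , Tw = (σ , av) , w≡
    where
    σ = toPartition (∈-words⁻ w∈words)
    w≡ : word σ ≡ w
    w≡ = word-toPartition (∈-words⁻ w∈words)
    av : σ Avoids π
    av c with from (d (∈-words⁻ w∈words)) (subst (_ContainsWord π) w≡ (to (contains⇔ σ π) c))
    ... | eq = subst T eq Tw

-- Sums of statistics and recurrences

private variable
  A B : Set

Σ[_] : List A → (A → ℤ) → ℤ
Σ[ []     ] f = 0ℤ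
Σ[ x ∷ xs ] f = f x ℤ.+ Σ[ xs ] f

Σ-cong : ∀ (xs : List A) {f g} → (∀ {x} → x ∈ˡ xs → f x ≡ g x) → Σ[ xs ] f ≡ Σ[ xs ] g
Σ-cong []       e = refl
Σ-cong (x ∷ xs) e = cong₂ ℤ._+_ (e (here refl)) (Σ-cong xs (e ∘ there))

Σ-++ : ∀ (xs ys : List A) f → Σ[ xs ++ ys ] f ≡ Σ[ xs ] f ℤ.+ Σ[ ys ] f
Σ-++ []       ys f = sym (ℤ.+-identityˡ _)
Σ-++ (x ∷ xs) ys f = trans (cong (λ s → f x ℤ.+ s) (Σ-++ xs ys f)) (sym (ℤ.+-assoc (f x) _ _))

Σ-map : ∀ (g : B → A) xs f → Σ[ List.map g xs ] f ≡ Σ[ xs ] (f ∘ g)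
Σ-map g []       f = refl
Σ-map g (x ∷ xs) f = cong (λ s → f (g x) ℤ.+ s) (Σ-map g xs f)

Σ-concatMap : ∀ (g : B → List A) xs f → Σ[ List.concatMap g xs ] f ≡ Σ[ xs ] (λ x → Σ[ g x ] f)
Σ-concatMap g []       f = refl
Σ-concatMap g (x ∷ xs) f =
  trans (Σ-++ (g x) _ f) (cong (λ s → Σ[ g x ] f ℤ.+ s) (Σ-concatMap g xs f))

Σ-linear : ∀ c (xs : List A) f g →
           Σ[ xs ] (λ x → c ℤ.* f x ℤ.+ g x) ≡ c ℤ.* Σ[ xs ] f ℤ.+ Σ[ xs ] g
Σ-linear c []       f g = sym (trans (ℤ.+-identityʳ _) (ℤ.*-zeroʳ c))
Σ-linear c (x ∷ xs) f g = trans (cong (λ s → c ℤ.* f x ℤ.+ g x ℤ.+ s) (Σ-linear c xs f g))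
                                (rearrange c (f x) (g x) _ _)
  where
  rearrange : ∀ c a b s t → c ℤ.* a ℤ.+ b ℤ.+ (c ℤ.* s ℤ.+ t) ≡ c ℤ.* (a ℤ.+ s) ℤ.+ (b ℤ.+ t)
  rearrange = solve-∀

Σ-zero : ∀ (xs : List A) {f} → (∀ {x} → x ∈ˡ xs → f x ≡ 0ℤ) → Σ[ xs ] f ≡ 0ℤ
Σ-zero []       e = refl
Σ-zero (x ∷ xs) e = cong₂ ℤ._+_ (e (here refl)) (Σ-zero xs (e ∘ there))

Σ-+ : ∀ (xs : List A) f g → Σ[ xs ] (λ x → f x ℤ.+ g x) ≡ Σ[ xs ] f ℤ.+ Σ[ xs ] g
Σ-+ xs f g = trans (Σ-cong xs (λ {x} _ → cong (λ t → t ℤ.+ g x) (sym (ℤ.*-identityˡ (f x)))))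
            (trans (Σ-linear 1ℤ xs f g) (cong (λ t → t ℤ.+ Σ[ xs ] g) (ℤ.*-identityˡ (Σ[ xs ] f))))

𝟙 : Bool → ℤ
𝟙 b = if b then 1ℤ else 0ℤ

length-filter : ∀ (p : A → Bool) xs → + length (List.filter (T? ∘ p) xs) ≡ Σ[ xs ] (𝟙 ∘ p)
length-filter p []       = refl
length-filter p (x ∷ xs) with p x
... | true  = cong (λ s → 1ℤ ℤ.+ s) (length-filter p xs)
... | false = trans (length-filter p xs) (sym (ℤ.+-identityˡ _))

Statistic : Set
Statistic = ∀ {n} → Vec ℕ n → ℤ

total : Statistic → ℕ → ℤ
total F n = Σ[ words n ] F

transfer : Statistic → Statistic
transfer F w = Σ[ List.downFrom (suc (nb w)) ] (λ c → F (c ∷ w))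

total-suc : ∀ (F : Statistic) n → total F (suc n) ≡ total (transfer F) n
total-suc F n = trans (Σ-concatMap extensions (words n) F)
                      (Σ-cong (words n) (λ {w} _ → Σ-map (_∷ w) (List.downFrom (suc (nb w))) F))

total-cong : ∀ {F G : Statistic} → (∀ {n} {w : Vec ℕ n} → RGF w → F w ≡ G w) →
             ∀ n → total F n ≡ total G n
total-cong e n = Σ-cong (words n) (e ∘ ∈-words⁻)

-- A sequence is C-finite when it is killed by some composite of operators
-- E − c, where E is the shift.

data CFinite (a : ℕ → ℤ) : Set where
  zero : (∀ n → a n ≡ 0ℤ) → CFinite a
  step : ∀ c → CFinite (λ n → a (suc n) ℤ.- c ℤ.* a n) → CFinite a

CFinite-cong : ∀ {a b} → (∀ n → a n ≡ b n) → CFinite a → CFinite b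
CFinite-cong e (zero z)   = zero λ n → trans (sym (e n)) (z n)
CFinite-cong e (step c p) =
  step c (CFinite-cong (λ n → cong₂ (λ x y → x ℤ.- c ℤ.* y) (e (suc n)) (e n)) p)

-- `E − c` commutes with every factor `E − d` of the annihilator, which therefore kills the new
-- sequence as well.
CFinite-shift : ∀ {a} c → CFinite a → CFinite (λ n → a (suc n) ℤ.- c ℤ.* a n)
CFinite-shift c (zero z)   = zero λ n →
  trans (cong₂ (λ x y → x ℤ.- c ℤ.* y) (z (suc n)) (z n)) (solve-zero c)
  where
  solve-zero : ∀ c → 0ℤ ℤ.- c ℤ.* 0ℤ ≡ 0ℤ
  solve-zero = solve-∀
CFinite-shift {a} c (step d p) =
  step d (CFinite-cong (λ n → commute c d (a n) (a (suc n)) (a (suc (suc n)))) (CFinite-shift c p))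
  where
  commute : ∀ c d x y z → z ℤ.- d ℤ.* y ℤ.- c ℤ.* (y ℤ.- d ℤ.* x) ≡
                          z ℤ.- c ℤ.* y ℤ.- d ℤ.* (y ℤ.- c ℤ.* x)
  commute = solve-∀

-- The product of the two annihilators kills the sum: the factors of the first are peeled off one at
-- a time, and `CFinite-shift` carries the second sequence along.
CFinite-+ : ∀ {a b} → CFinite a → CFinite b → CFinite (λ n → a n ℤ.+ b n)
CFinite-+ (zero z)           q =
  CFinite-cong (λ n → sym (trans (cong (λ x → x ℤ.+ _) (z n)) (ℤ.+-identityˡ _))) q
CFinite-+ {a} {b} (step c p) q =
  step c (CFinite-cong (λ n → distrib c (a n) (a (suc n)) (b n) (b (suc n)))
                       (CFinite-+ p (CFinite-shift c q)))
  where
  distrib : ∀ c x y u v → y ℤ.- c ℤ.* x ℤ.+ (v ℤ.- c ℤ.* u) ≡ y ℤ.+ v ℤ.- c ℤ.* (x ℤ.+ u)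
  distrib = solve-∀

-- `transfer` acts on totals as the shift, so the hypothesis becomes `(E − c) (total F) = total G`.
-- This is one row of a triangular system: c is the diagonal entry and G collects the states treated
-- before F.
total-CFinite : ∀ (F G : Statistic) c →
  (∀ {n} {w : Vec ℕ n} → RGF w → transfer F w ≡ c ℤ.* F w ℤ.+ G w) →
  CFinite (total G) → CFinite (total F)
total-CFinite F G c e p = step c (CFinite-cong (λ n → sym (trans
    (cong (λ x → x ℤ.- c ℤ.* total F n)
      (trans (total-suc F n) (trans (total-cong e n) (Σ-linear c (words n) F G))))
    (cancel (c ℤ.* total F n) (total G n)))) p)
  where
  cancel : ∀ x y → x ℤ.+ y ℤ.- x ≡ y
  cancel = solve-∀

-- The argument x is kept apart from the index n, because the recursion advances the index while the
-- polynomials stay at the same point.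
combination : List Poly → (ℕ → ℤ) → ℕ → ℤ → ℤ
combination []       a n x = 0ℤ
combination (p ∷ ps) a n x = eval p x ℤ.* a n ℤ.+ combination ps a (suc n) x

sum-combination : ∀ ps a n x →
  sum ℤ.+-0-monoid (λ i → eval (List.lookup ps i) x ℤ.* a (n ℕ.+ toℕ i)) ≡ combination ps a n x
sum-combination []       a n x = refl
sum-combination (p ∷ ps) a n x = cong₂ ℤ._+_
  (cong (λ k → eval p x ℤ.* a k) (ℕ.+-identityʳ n))
  (trans (sum-cong (λ i → cong (λ k → eval (List.lookup ps i) x ℤ.* a k) (ℕ.+-suc n (toℕ i))))
         (sum-combination ps a (suc n) x))
  where
  open import Algebra.Properties.Monoid.Sum ℤ.+-0-monoid using () renaming (sum-cong-≗ to sum-cong)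

combination⇒PRecursive : ∀ {a : ℕ → ℕ} ps → Any NonZeroPoly ps →
  (∀ n → combination ps (+_ ∘ a) n (+ n) ≡ 0ℤ) → PRecursive a
combination⇒PRecursive {a} (p ∷ ps) nz e = length ps , List.lookup (p ∷ ps)
  , (index nz , Any.lookup-index nz)
  , λ n → trans (sum-combination (p ∷ ps) (+_ ∘ a) n (+ n)) (e n)

-- The operator E^k + l_{k-1} E^{k-1} + ... + l_0 for the list l_0, ..., l_{k-1}.
monic : List ℤ → (ℕ → ℤ) → ℕ → ℤ
monic []      a n = a n
monic (l ∷ L) a n = l ℤ.* a n ℤ.+ monic L a (suc n)

-- (E − c) times the polynomial of L, plus the constant k.
times : ℤ → ℤ → List ℤ → List ℤ
times c k []      = (k ℤ.- c) ∷ []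
times c k (l ∷ L) = (k ℤ.- c ℤ.* l) ∷ times c l L

-- Multiplying by E moves each coefficient up one place; k is the coefficient carried over from the
-- place below.
monic-times : ∀ c k L a n →
  monic (times c k L) a n ≡ k ℤ.* a n ℤ.+ monic L (λ m → a (suc m) ℤ.- c ℤ.* a m) n
monic-times c k []      a n = base c k (a n) (a (suc n))
  where
  base : ∀ c k x y → (k ℤ.- c) ℤ.* x ℤ.+ y ≡ k ℤ.* x ℤ.+ (y ℤ.- c ℤ.* x)
  base = solve-∀
monic-times c k (l ∷ L) a n = trans
  (cong (λ s → (k ℤ.- c ℤ.* l) ℤ.* a n ℤ.+ s) (monic-times c l L a (suc n)))
  (rearrange c k l (a n) (a (suc n)) _)
  where
  rearrange : ∀ c k l x y s →
    (k ℤ.- c ℤ.* l) ℤ.* x ℤ.+ (l ℤ.* y ℤ.+ s) ≡ k ℤ.* x ℤ.+ (l ℤ.* (y ℤ.- c ℤ.* x) ℤ.+ s)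
  rearrange = solve-∀

CFinite⇒monic : ∀ {a} → CFinite a → ∃ λ L → ∀ n → monic L a n ≡ 0ℤ
CFinite⇒monic (zero z)   = [] , z
CFinite⇒monic {a} (step c p) with CFinite⇒monic p
... | L , e = times c 0ℤ L , λ n → trans (monic-times c 0ℤ L a n)
  (trans (ℤ.+-identityˡ _) (e n))

constants : List ℤ → List Poly
constants []      = (1ℤ ∷ []) ∷ []
constants (l ∷ L) = (l ∷ []) ∷ constants L

combination-constants : ∀ L a n x → combination (constants L) a n x ≡ monic L a n
combination-constants [] a n x = one x (a n)
  where
  one : ∀ x y → (1ℤ ℤ.+ x ℤ.* 0ℤ) ℤ.* y ℤ.+ 0ℤ ≡ y
  one = solve-∀
combination-constants (l ∷ L) a n x = cong₂ ℤ._+_ (const l x (a n)) (combination-constants L a (suc n) x)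
  where
  const : ∀ l x y → (l ℤ.+ x ℤ.* 0ℤ) ℤ.* y ≡ l ℤ.* y
  const = solve-∀

CFinite⇒PRecursive : ∀ {a : ℕ → ℕ} → CFinite (+_ ∘ a) → PRecursive a
CFinite⇒PRecursive {a} p with CFinite⇒monic p
... | L , e = combination⇒PRecursive (constants L) (nonzero L)
                (λ n → trans (combination-constants L (+_ ∘ a) n (+ n)) (e n))
  where
  nonzero : ∀ L → Any NonZeroPoly (constants L)
  nonzero []      = here (here λ ())
  nonzero (l ∷ L) = there (nonzero L)

number : (∀ {n} → Vec ℕ n → Bool) → ℕ → ℕ
number good n = length (List.filter (T? ∘ good) (words n))

number-total : ∀ (good : ∀ {n} → Vec ℕ n → Bool) n → + number good n ≡ total (𝟙 ∘ good) n
number-total good n = length-filter good (words n)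

CFinite⇒CountIsPRecursive : ∀ {k} (π : Partition k) (good : ∀ {n} → Vec ℕ n → Bool) → good Decides π →
  CFinite (total (𝟙 ∘ good)) → CountIsPRecursive π
CFinite⇒CountIsPRecursive π good d p = number good , avoiders-cardinality π good d ,
  CFinite⇒PRecursive (CFinite-cong (λ n → sym (number-total good n)) p)

-- Recognising the avoiders

≡ᵇ-true : ∀ {m n} → m ≡ n → (m ≡ᵇ n) ≡ true
≡ᵇ-true {m} {n} eq with m ≡ᵇ n | ≡⇒≡ᵇ m n eq
... | true | _ = refl

≡ᵇ-false : ∀ {m n} → m ≢ n → (m ≡ᵇ n) ≡ false
≡ᵇ-false {m} {n} neq with m ≡ᵇ n | ≡ᵇ⇒≡ m n
... | false | _ = refl
... | true  | f = contradiction (f _) neq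

≡ᵇ-true⁻ : ∀ {m n} → (m ≡ᵇ n) ≡ true → m ≡ n
≡ᵇ-true⁻ {m} {n} eq = ≡ᵇ⇒≡ m n (subst T (sym eq) _)

≡ᵇ-false⁻ : ∀ {m n} → (m ≡ᵇ n) ≡ false → m ≢ n
≡ᵇ-false⁻ {m} {n} eq m≡n with trans (sym eq) (≡ᵇ-true m≡n)
... | ()

<ᵇ-true : ∀ {m n} → m < n → (m <ᵇ n) ≡ true
<ᵇ-true {m} {n} lt with m <ᵇ n | <⇒<ᵇ lt
... | true | _ = refl

<ᵇ-false : ∀ {m n} → n ≤ m → (m <ᵇ n) ≡ false
<ᵇ-false {m} {n} ge with m <ᵇ n | <ᵇ⇒< m n
... | false | _ = refl
... | true  | f = contradiction (f _) (≤⇒≯ ge)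

<ᵇ-false⁻ : ∀ {m n} → (m <ᵇ n) ≡ false → n ≤ m
<ᵇ-false⁻ {m} {n} eq with m <? n
... | no m≮n  = ≮⇒≥ m≮n
... | yes m<n with trans (sym eq) (<ᵇ-true m<n)
...   | ()

[]⊑ : ∀ {n} (w : Vec ℕ n) → [] ⊑ w
[]⊑ []      = []
[]⊑ (c ∷ w) = skip ([]⊑ w)

⊑-tail : ∀ {k n a} {v : Vec ℕ k} {w : Vec ℕ n} → a ∷ v ⊑ w → v ⊑ w
⊑-tail (skip p) = skip (⊑-tail p)
⊑-tail (keep p) = skip p

⊑-skip⁻ : ∀ {k n a c} {v : Vec ℕ k} {w : Vec ℕ n} → a ≢ c → a ∷ v ⊑ c ∷ w → a ∷ v ⊑ w
⊑-skip⁻ a≢c (skip p) = p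
⊑-skip⁻ a≢c (keep p) = contradiction refl a≢c

⊑-bounded : ∀ {k n} {v : Vec ℕ k} {w : Vec ℕ n} → v ⊑ w → Allᵛ (_< nb w) v
⊑-bounded [] = []
⊑-bounded (skip {c = c} p) = Allᵛ.map (m≤n⇒m≤o⊔n (suc c)) (⊑-bounded p)
⊑-bounded {w = c ∷ w} (keep p) =
  m≤m⊔n (suc c) (nb w) ∷ Allᵛ.map (m≤n⇒m≤o⊔n (suc c)) (⊑-bounded p)

head<nb : ∀ {k n a} {v : Vec ℕ k} {w : Vec ℕ n} → a ∷ v ⊑ w → a < nb w
head<nb p with ⊑-bounded p
... | a< ∷ _ = a<

occurs : ∀ {n} {w : Vec ℕ n} → RGF w → ∀ {c} → c < nb w → c ∷ [] ⊑ w
occurs {w = w} r c< with RGF-surjective r c<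
... | x , refl = at w x
  where
  at : ∀ {n} (w : Vec ℕ n) x → lookup w x ∷ [] ⊑ w
  at (c ∷ w) zero    = keep ([]⊑ w)
  at (c ∷ w) (suc x) = skip (at w x)

Ker-Distinct : ∀ {k} {v : Vec ℕ k} → Distinct v ⇔ (∀ i j → Ker v i j → i ≡ j)
Ker-Distinct {v = v} = mk⇔ Distinct.lookup-injective
  λ inj → subst Distinct (Vec.tabulate∘lookup v) (Distinct.tabulate⁺ (inj _ _))

Distinct-≤ : ∀ {k K} {v : Vec ℕ k} → Distinct v → Allᵛ (_< K) v → k ≤ K
Distinct-≤ {v = v} u b = Fin.injective⇒≤ {f = λ i → fromℕ< (Allᵛ.lookup⁺ b i)}
  λ {i} {j} eq → Distinct.lookup-injective u i j
    (Fin.fromℕ<-injective _ _ (Allᵛ.lookup⁺ b i) (Allᵛ.lookup⁺ b j) eq)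

-- Each block is represented by its largest element, where its letter is introduced. The chosen
-- letters then decrease along the word, and `⊑-bounded` gives their distinctness. Where a letter d
-- is introduced there are three cases: an older c lets d be taken; c equal to d passes it over; and
-- if c is fresh for the whole word, d is taken and plays the role of c from there on.
distinct-subword : ∀ {n} {w : Vec ℕ n} → RGF w → ∀ {c} N → c ≤ nb w → N < nb (c ∷ w) →
                   Σ (Vec ℕ N) λ u → u ⊑ w × Distinct (c ∷ u)
distinct-subword r zero c≤ N< = [] , []⊑ _ , [] ∷ []
distinct-subword [] (suc N) z≤n (s≤s ())
distinct-subword {w = d ∷ w} (d≤ ∷ r) {c} (suc N) c≤ N< with m≤n⇒m<n∨m≡n d≤
... | inj₁ d< with distinct-subword r (suc N) (subst (c ≤_) (nb-old {w = w} d<) c≤)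
                     (subst (λ k → suc N < suc c ⊔ k) (nb-old {w = w} d<) N<)
...   | u , u⊑ , D = u , skip u⊑ , D
distinct-subword {w = .(nb w) ∷ w} (d≤ ∷ r) {c} (suc N) c≤ N< | inj₂ refl
  with <-cmp c (nb w)
... | tri< c< c≢ _ with distinct-subword r {c} N (<⇒≤ c<)
                          (subst (N <_) (sym (nb-old {w = w} c<))
                            (≤-pred (subst (suc N <_) (trans (nb-old {w = nb w ∷ w} c<′) (nb-new w)) N<)))
  where c<′ = subst (c <_) (sym (nb-new w)) (m<n⇒m<1+n c<)
...   | u , u⊑ , c∉ ∷ D = nb w ∷ u , keep u⊑ ,
        (c≢ ∷ c∉) ∷ (Allᵛ.map (λ x< → <⇒≢ x< ∘ sym) (⊑-bounded u⊑) ∷ D)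
distinct-subword {w = .(nb w) ∷ w} (d≤ ∷ r) {c} (suc N) c≤ N< | inj₂ refl
    | tri≈ _ refl _ with distinct-subword r {nb w} (suc N) ≤-refl
                          (subst (suc N <_) (nb-old {w = nb w ∷ w} (lookup<nb (nb w ∷ w) zero)) N<)
...   | u , u⊑ , D = u , skip u⊑ , D
distinct-subword {w = .(nb w) ∷ w} (d≤ ∷ r) {c} (suc N) c≤ N< | inj₂ refl
    | tri> _ c≢ c> with ≤-antisym (subst (c ≤_) (nb-new w) c≤) c>
...   | refl with distinct-subword r {nb w} N ≤-refl (subst (N <_) (sym (nb-new w))
                   (≤-pred (subst (suc N <_) (trans (cong (λ k → suc (suc (nb w)) ⊔ k) (nb-new w))
                             (m≥n⇒m⊔n≡m (n≤1+n _))) N<)))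
...     | u , u⊑ , d∉ ∷ D = nb w ∷ u , keep u⊑ ,
          (c≢ ∷ Allᵛ.map (λ x< → <⇒≢ (m<n⇒m<1+n x<) ∘ sym) (⊑-bounded u⊑)) ∷ (d∉ ∷ D)

Distinct-<nb : ∀ {N n c} {u : Vec ℕ N} {w : Vec ℕ n} → u ⊑ w → Distinct (c ∷ u) → N < nb (c ∷ w)
Distinct-<nb {c = c} {w = w} u⊑ D =
  Distinct-≤ D (m≤m⊔n (suc c) (nb w) ∷ Allᵛ.map (m≤n⇒m≤o⊔n (suc c)) (⊑-bounded u⊑))

fewBlocks : ℕ → ∀ {n} → Vec ℕ n → Bool
fewBlocks m w = nb w <ᵇ m

fewBlocks-decides : ∀ {m} (π : Partition m) → (∀ i j → SameBlock (blocks π) i j → i ≡ j) →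
                    fewBlocks m Decides π
fewBlocks-decides {m} π π-id {w = w} r = mk⇔ f g
  where
  f : fewBlocks m w ≡ false → w ContainsWord π
  -- The letter to be avoided is chosen as the fresh `nb w`, which costs none of the letters of w.
  f eq with distinct-subword r m ≤-refl (subst (m <_) (sym (nb-new w)) (s≤s (<ᵇ-false⁻ eq)))
  ... | v , v⊑ , _ ∷ D = v , v⊑ , λ i j → mk⇔
    (λ e → subst (SameBlock (blocks π) i) (to Ker-Distinct D i j e) (sameBlock-refl π ∈⊤))
    (λ e → cong (lookup v) (π-id i j e))
  g : w ContainsWord π → fewBlocks m w ≡ false
  g (v , v⊑ , μ) = <ᵇ-false (Distinct-≤ {v = v} (from Ker-Distinct λ i j → π-id i j ∘ to (μ i j)) (⊑-bounded v⊑))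

∧-falseˡ : ∀ {a b} → a ≡ false → a ∧ b ≡ false
∧-falseˡ refl = refl

-- Pins down 12/3/.../m by its relation alone, so that a partition of [3] known only through its
-- word is covered together with `pairAndSingletons`.
record PairPattern {N} (π : Partition (suc (suc N))) : Set where
  field
    paired   : SameBlock (blocks π) zero (suc zero)
    separate : ∀ i j → SameBlock (blocks π) (suc i) (suc j) → i ≡ j

  matchedBy⁻ : ∀ {a b v} → π MatchedBy (a ∷ b ∷ v) → a ≡ b × Distinct (b ∷ v)
  matchedBy⁻ μ = from (μ zero (suc zero)) paired
               , from Ker-Distinct (λ i j → separate i j ∘ to (μ (suc i) (suc j)))

  -- Both the kernel of the word and the relation of π factor through `merge`, which identifies
  -- positions 0 and 1; after the identification both are plain equality.
  matchedBy⁺ : ∀ {a v} → Distinct (a ∷ v) → π MatchedBy (a ∷ a ∷ v)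
  matchedBy⁺ {a} {v} D i j = mk⇔
    (λ e → trans′ (subst (SameBlock (blocks π) i)
             (cong suc (to Ker-Distinct D _ _ (trans (sym (lookup-merge i)) (trans e (lookup-merge j)))))
             (merged i)) (sameBlock-sym (merged j)))
    (λ e → trans (lookup-merge i) (trans (cong (lookup (a ∷ v))
             (separate _ _ (trans′ (sameBlock-sym (merged i)) (trans′ e (merged j)))))
             (sym (lookup-merge j))))
    where
    trans′ : ∀ {x y z} → SameBlock (blocks π) x y → SameBlock (blocks π) y z → SameBlock (blocks π) x z
    trans′ = sameBlock-trans (disjoint π)
    merge : Fin (suc (suc _)) → Fin (suc _)
    merge zero    = zero
    merge (suc i) = i
    merged : ∀ i → SameBlock (blocks π) i (suc (merge i))
    merged zero    = paired
    merged (suc i) = sameBlock-refl π ∈⊤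
    lookup-merge : ∀ i → lookup (a ∷ a ∷ v) i ≡ lookup (a ∷ v) (merge i)
    lookup-merge zero    = refl
    lookup-merge (suc i) = refl

-- joinable N w b: fewer than N blocks other than b have elements above the
-- minimum of block b.

joinable : ℕ → ∀ {n} → Vec ℕ n → ℕ → Bool
joinable N []      b = false
joinable N (c ∷ w) b = if c ≡ᵇ b then nb (c ∷ w) <ᵇ suc N else joinable N w b

-- An occurrence through the head uses it as the first element of the pair. A fresh letter completes
-- no pair, and an old letter c completes the pattern exactly when N other blocks lie above some
-- element of block c.
pairFree : ℕ → ∀ {n} → Vec ℕ n → Bool
pairFree N []      = true
pairFree N (c ∷ w) = pairFree N w ∧ ((c ≡ᵇ nb w) ∨ joinable N w c)

-- The occurrence of c nearest to the head has the longest suffix, hence the most letters to choose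
-- from, so it alone needs testing. The bound is `suc N` because block c itself is counted in `nb`.
joinable-false : ∀ {N n} {w : Vec ℕ n} → RGF w → ∀ {c} → c < nb w →
  (joinable N w c ≡ false) ⇔ (Σ (Vec ℕ N) λ u → c ∷ u ⊑ w × Distinct (c ∷ u))
joinable-false {N} {w = d ∷ w} (d≤ ∷ r) {c} c< with d ≡ᵇ c in d≡ᵇc
... | true with ≡ᵇ-true⁻ {d} d≡ᵇc
...   | refl = mk⇔ f g
  where
  f : (nb (c ∷ w) <ᵇ suc N) ≡ false → Σ (Vec ℕ N) λ u → c ∷ u ⊑ c ∷ w × Distinct (c ∷ u)
  f eq with distinct-subword r N d≤ (<ᵇ-false⁻ eq)
  ... | u , u⊑ , D = u , keep u⊑ , D
  g : (Σ (Vec ℕ N) λ u → c ∷ u ⊑ c ∷ w × Distinct (c ∷ u)) → (nb (c ∷ w) <ᵇ suc N) ≡ false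
  g (u , keep u⊑ , D) = <ᵇ-false (Distinct-<nb u⊑ D)
  g (u , skip p  , D) = <ᵇ-false (Distinct-<nb (⊑-tail p) D)
joinable-false {N} {w = d ∷ w} (d≤ ∷ r) {c} c< | false = mk⇔
  (λ eq → let u , p , D = to ih eq in u , skip p , D)
  (λ (u , p , D) → from ih (u , ⊑-skip⁻ c≢d p , D))
  where
  c≢d : c ≢ d
  c≢d = ≡ᵇ-false⁻ {d} d≡ᵇc ∘ sym
  c<′ : c < nb w
  c<′ with m≤n⇒m<n∨m≡n d≤
  ... | inj₁ d<   = subst (c <_) (nb-old {w = w} d<) c<
  ... | inj₂ refl = ≤∧≢⇒< (≤-pred (subst (c <_) (nb-new w) c<)) c≢d
  ih = joinable-false {N} r c<′

pairFree-decides : ∀ {N} (π : Partition (suc (suc N))) → PairPattern π → pairFree N Decides π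
pairFree-decides {N} π P r = mk⇔ (f r) (λ { (v , p , μ) → g r v p μ })
  where
  open PairPattern P
  f : ∀ {n} {w : Vec ℕ n} → RGF w → pairFree N w ≡ false → w ContainsWord π
  f {w = c ∷ w} (c≤ ∷ r) eq with pairFree N w in free
  ... | false = let v , v⊑ , μ = f r free in v , skip v⊑ , μ
  ... | true with c ≡ᵇ nb w in c≡ᵇ
  ...   | false with to (joinable-false r (≤∧≢⇒< c≤ (≡ᵇ-false⁻ {c} c≡ᵇ))) eq
  ...     | u , p , D = c ∷ c ∷ u , keep p , matchedBy⁺ D
  g : ∀ {n} {w : Vec ℕ n} → RGF w → ∀ v → v ⊑ w → π MatchedBy v → pairFree N w ≡ false
  g {w = c ∷ w} (_ ∷ r) v (skip p) μ = ∧-falseˡ (g r v p μ)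
  g {w = c ∷ w} (_ ∷ r) (_ ∷ b ∷ u) (keep p) μ with matchedBy⁻ μ
  ... | refl , D = trans (cong (pairFree N w ∧_)
          (cong₂ _∨_ (≡ᵇ-false (<⇒≢ c<)) (from (joinable-false r c<) (u , p , D)))) (∧-zeroʳ _)
    where c< = head<nb p

-- An automaton for 1/23, whose occurrences are the subwords a b b with a different from b. Every
-- letter is fresh until a first repetition, of some b; from then on every further letter must be b.
data LumpState : Set where
  discrete bad : LumpState
  lump         : ℕ → LumpState

lumpStep : LumpState → ℕ → ℕ → LumpState
lumpStep discrete c k = if c ≡ᵇ k then discrete else lump c
lumpStep (lump b) c k = if c ≡ᵇ b then lump b else bad
lumpStep bad      c k = bad

lumpState : ∀ {n} → Vec ℕ n → LumpState
lumpState []      = discrete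
lumpState (c ∷ w) = lumpStep (lumpState w) c (nb w)

notBad : LumpState → Bool
notBad bad = false
notBad _   = true

LumpInvariant : LumpState → ∀ {n} → Vec ℕ n → Set
LumpInvariant discrete w = ∀ {b} → ¬ (b ∷ b ∷ [] ⊑ w)
LumpInvariant (lump b) w = b ∷ b ∷ [] ⊑ w × (∀ {c} → c ∷ c ∷ [] ⊑ w → c ≡ b) ×
                           (∀ {a c} → a ≢ c → ¬ (a ∷ c ∷ c ∷ [] ⊑ w))
LumpInvariant bad      w = ∃₂ λ a b → a ≢ b × a ∷ b ∷ b ∷ [] ⊑ w

lumpInvariant : ∀ {n} {w : Vec ℕ n} → RGF w → LumpInvariant (lumpState w) w
lumpInvariant [] ()
lumpInvariant {w = c ∷ w} (c≤ ∷ r) with lumpState w | lumpInvariant r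
... | discrete | none with c ≡ᵇ nb w in c≡ᵇ
...   | true  = λ { (skip p) → none p ; (keep p) → <⇒≢ (head<nb p) (≡ᵇ-true⁻ {c} c≡ᵇ) }
...   | false = keep (occurs r (≤∧≢⇒< c≤ (≡ᵇ-false⁻ {c} c≡ᵇ)))
              , (λ { (skip p) → contradiction p none ; (keep p) → refl })
              , (λ { _ (skip p) → none (⊑-tail p) ; _ (keep p) → none p })
lumpInvariant {w = c ∷ w} (c≤ ∷ r) | lump b | bb , only , free with c ≡ᵇ b in c≡ᵇ
...   | true with ≡ᵇ-true⁻ {c} c≡ᵇ
...     | refl = skip bb
               , (λ { (skip p) → only p ; (keep p) → refl })
               , (λ { a≢ (skip p) → free a≢ p ; a≢ (keep p) → a≢ (sym (only p)) })
lumpInvariant {w = c ∷ w} (c≤ ∷ r) | lump b | bb , only , free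
      | false = c , b , ≡ᵇ-false⁻ {c} c≡ᵇ , keep bb
lumpInvariant {w = c ∷ w} (c≤ ∷ r) | bad | a , b , a≢b , p = a , b , a≢b , skip p

lumpFree : ∀ {n} → Vec ℕ n → Bool
lumpFree w = notBad (lumpState w)

lumpFree-decides : ∀ (π : Partition 3) → (∀ {a b c} → π MatchedBy (a ∷ b ∷ c ∷ []) ⇔ (a ≢ b × b ≡ c)) →
                   lumpFree Decides π
lumpFree-decides π shape {w = w} r with lumpState w | lumpInvariant r
... | discrete | none = mk⇔ (λ ()) λ { (a ∷ b ∷ c ∷ [] , p , μ) → no-match p (to shape μ) }
  where
  no-match : ∀ {a b c} → a ∷ b ∷ c ∷ [] ⊑ w → a ≢ b × b ≡ c → true ≡ false
  no-match p (_ , refl) = contradiction (⊑-tail p) none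
... | lump b | bb , only , free = mk⇔ (λ ()) λ { (a ∷ b ∷ c ∷ [] , p , μ) → no-match p (to shape μ) }
  where
  no-match : ∀ {a b c} → a ∷ b ∷ c ∷ [] ⊑ w → a ≢ b × b ≡ c → true ≡ false
  no-match p (a≢b , refl) = contradiction p (free a≢b)
... | bad | a , b , a≢b , p = mk⇔ (λ _ → a ∷ b ∷ b ∷ [] , p , from shape (a≢b , refl)) (λ _ → refl)

-- The avoiders of 13/2 are the partitions into intervals: the next element continues the current
-- block or opens a new one.
layered : ∀ {n} → Vec ℕ n → Bool
layered []          = true
layered (c ∷ [])    = true
layered (c ∷ d ∷ w) = layered (d ∷ w) ∧ ((c ≡ᵇ d) ∨ (c ≡ᵇ nb (d ∷ w)))

-- A letter c that is neither d nor fresh recurs beyond d, which gives c d c. Conversely, an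
-- occurrence a b a starting at the head can be moved one place into the tail as long as the next
-- letter is again a; once it is not, the head violates the condition.
layered-decides : ∀ (π : Partition 3) → (∀ {a b c} → π MatchedBy (a ∷ b ∷ c ∷ []) ⇔ (a ≢ b × a ≡ c)) →
                  layered Decides π
layered-decides π shape r = mk⇔
  (λ eq → let a , b , a≢b , p = f r eq in a ∷ b ∷ a ∷ [] , p , from shape (a≢b , refl))
  (λ { (a ∷ b ∷ c ∷ [] , p , μ) → g′ r p (to shape μ) })
  where
  f : ∀ {n} {w : Vec ℕ n} → RGF w → layered w ≡ false → ∃₂ λ a b → a ≢ b × a ∷ b ∷ a ∷ [] ⊑ w
  f {w = c ∷ d ∷ w} (c≤ ∷ r) eq with layered (d ∷ w) in lay
  ... | false = let a , b , a≢b , p = f r lay in a , b , a≢b , skip p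
  ... | true with c ≡ᵇ d in c≡ᵇd
  ...   | false with c ≡ᵇ nb (d ∷ w) in c≡ᵇnb
  ...     | false = c , d , c≢d ,
                    keep (keep (⊑-skip⁻ c≢d (occurs r (≤∧≢⇒< c≤ (≡ᵇ-false⁻ {c} c≡ᵇnb)))))
    where c≢d = ≡ᵇ-false⁻ {c} c≡ᵇd
  g : ∀ {n a b} {w : Vec ℕ n} → RGF w → a ≢ b → a ∷ b ∷ a ∷ [] ⊑ w → layered w ≡ false
  g {w = c ∷ []}    _       a≢b (skip ())
  g {w = c ∷ []}    _       a≢b (keep ())
  g {w = c ∷ d ∷ w} (_ ∷ r) a≢b (skip p) = ∧-falseˡ (g r a≢b p)
  g {a = a} {w = c ∷ d ∷ w} (_ ∷ r) a≢b (keep p) with a ≡ᵇ d in a≡ᵇd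
  ... | true with ≡ᵇ-true⁻ {a} a≡ᵇd
  ...   | refl = ∧-falseˡ (g r a≢b (keep (⊑-skip⁻ (a≢b ∘ sym) p)))
  g {a = a} {w = c ∷ d ∷ w} (_ ∷ r) a≢b (keep p)
      | false = trans (cong (layered (d ∷ w) ∧_) (≡ᵇ-false (<⇒≢ (head<nb (⊑-tail p))))) (∧-zeroʳ _)
  g′ : ∀ {n a b c} {w : Vec ℕ n} → RGF w → a ∷ b ∷ c ∷ [] ⊑ w → a ≢ b × a ≡ c → layered w ≡ false
  g′ r p (a≢b , refl) = g r a≢b p

-- Counting the avoiders

total-zero : ∀ (F : Statistic) → (∀ {n} {w : Vec ℕ n} → RGF w → F w ≡ 0ℤ) → CFinite (total F)
total-zero F e = zero λ n → Σ-zero (words n) (e ∘ ∈-words⁻)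

total-+ : ∀ (F G : Statistic) → CFinite (total F) → CFinite (total G) →
          CFinite (total (λ w → F w ℤ.+ G w))
total-+ F G p q = CFinite-cong (λ n → sym (Σ-+ (words n) F G)) (CFinite-+ p q)

CFinite-* : ∀ {a} c → CFinite a → CFinite (λ n → c ℤ.* a n)
CFinite-* c (zero z)       = zero λ n → trans (cong (λ x → c ℤ.* x) (z n)) (ℤ.*-zeroʳ c)
CFinite-* {a} c (step d p) =
  step d (CFinite-cong (λ n → distrib c d (a n) (a (suc n))) (CFinite-* c p))
  where
  distrib : ∀ c d x y → c ℤ.* (y ℤ.- d ℤ.* x) ≡ c ℤ.* y ℤ.- d ℤ.* (c ℤ.* x)
  distrib = solve-∀

Σ-* : ∀ {A : Set} c (xs : List A) f → Σ[ xs ] (λ x → c ℤ.* f x) ≡ c ℤ.* Σ[ xs ] f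
Σ-* c []       f = sym (ℤ.*-zeroʳ c)
Σ-* c (x ∷ xs) f = trans (cong (λ s → c ℤ.* f x ℤ.+ s) (Σ-* c xs f))
                         (sym (ℤ.*-distribˡ-+ c (f x) (Σ[ xs ] f)))

total-* : ∀ c (F : Statistic) → CFinite (total F) → CFinite (total (λ w → c ℤ.* F w))
total-* c F p = CFinite-cong (λ n → sym (Σ-* c (words n) F)) (CFinite-* c p)

total-Σ : ∀ (F : ℕ → Statistic) → (∀ k → CFinite (total (F k))) →
          ∀ m → CFinite (total (λ w → Σ[ List.downFrom m ] (λ k → F k w)))
total-Σ F p zero    = total-zero (λ _ → 0ℤ) (λ _ → refl)
total-Σ F p (suc m) = total-+ (F m) (λ w → Σ[ List.downFrom m ] (λ k → F k w)) (p m) (total-Σ F p m)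

Σ-const : ∀ k {f : ℕ → ℤ} {x} → (∀ {c} → c < k → f c ≡ x) → Σ[ List.downFrom k ] f ≡ + k ℤ.* x
Σ-const zero    {x = x} e = refl
Σ-const (suc k) {x = x} e = trans (cong₂ ℤ._+_ (e ≤-refl) (Σ-const k (e ∘ m<n⇒m<1+n)))
                                  (sym (ℤ.suc-* (+ k) x))

Σ-δ : ∀ b k → Σ[ List.downFrom k ] (λ c → 𝟙 (b ≡ᵇ c)) ≡ 𝟙 (b <ᵇ k)
Σ-δ b zero    = cong 𝟙 (sym (<ᵇ-false {b} {0} z≤n))
Σ-δ b (suc k) with <-cmp b k
... | tri< b<k b≢k _ = trans (cong₂ ℤ._+_ (cong 𝟙 (≡ᵇ-false b≢k))
                                   (trans (Σ-δ b k) (cong 𝟙 (<ᵇ-true b<k))))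
                             (cong 𝟙 (sym (<ᵇ-true (m<n⇒m<1+n b<k))))
... | tri≈ _ refl _ = trans (cong₂ ℤ._+_ (cong 𝟙 (≡ᵇ-true {b} refl))
                                   (trans (Σ-δ b b) (cong 𝟙 (<ᵇ-false {b} ≤-refl))))
                            (cong 𝟙 (sym (<ᵇ-true (n<1+n b))))
... | tri> _ b≢k k<b = trans (cong₂ ℤ._+_ (cong 𝟙 (≡ᵇ-false b≢k))
                                   (trans (Σ-δ b k) (cong 𝟙 (<ᵇ-false {b} (<⇒≤ k<b)))))
                             (cong 𝟙 (sym (<ᵇ-false k<b)))

≡ᵇ-sym : ∀ m n → (m ≡ᵇ n) ≡ (n ≡ᵇ m)
≡ᵇ-sym zero    zero    = refl
≡ᵇ-sym zero    (suc n) = refl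
≡ᵇ-sym (suc m) zero    = refl
≡ᵇ-sym (suc m) (suc n) = ≡ᵇ-sym m n

Σ-δ₁ : ∀ {b k} → b < k → Σ[ List.downFrom k ] (λ c → 𝟙 (c ≡ᵇ b)) ≡ 1ℤ
Σ-δ₁ {b} {k} b<k = trans (Σ-cong (List.downFrom k) (λ {c} _ → cong 𝟙 (≡ᵇ-sym c b)))
                         (trans (Σ-δ b k) (cong 𝟙 (<ᵇ-true b<k)))

-- Under the indicator of `n ≡ k` the varying weight n becomes the constant k, as `total-CFinite`
-- requires of its coefficient.
δ-weight : ∀ n k → + n ℤ.* 𝟙 (n ≡ᵇ k) ≡ + k ℤ.* 𝟙 (n ≡ᵇ k)
δ-weight n k with n ≡ᵇ k in eq
... | true  = cong (λ j → + j ℤ.* 1ℤ) (≡ᵇ-true⁻ {n} eq)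
... | false = trans (ℤ.*-zeroʳ (+ n)) (sym (ℤ.*-zeroʳ (+ k)))

exactly : ℕ → Statistic
exactly k w = 𝟙 (nb w ≡ᵇ k)

-- The totals are the Stirling numbers of the second kind, and the second clause is S(n+1, k+1) =
-- (k+1) S(n, k+1) + S(n, k).
exactly-CFinite : ∀ k → CFinite (total (exactly k))
exactly-CFinite zero = total-CFinite (exactly 0) (λ _ → 0ℤ) 0ℤ
  (λ {_} {w} r → cong₂ ℤ._+_
    (cong (λ k → 𝟙 (k ≡ᵇ 0)) (nb-new w))
    (Σ-zero (List.downFrom (nb w)) (λ c∈ → let c< = ∈-downFrom⁻ c∈ in cong 𝟙
      (≡ᵇ-false (λ e → n≮0 (subst (_ <_) (trans (sym (nb-old {w = w} c<)) e) c<))))))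
  (total-zero (λ _ → 0ℤ) (λ _ → refl))
exactly-CFinite (suc k) = total-CFinite (exactly (suc k)) (exactly k) (+ suc k)
  (λ {_} {w} r → trans (cong₂ ℤ._+_ (cong (λ j → 𝟙 (j ≡ᵇ suc k)) (nb-new w))
                                    (trans (Σ-const (nb w) (λ c< → cong (λ j → 𝟙 (j ≡ᵇ suc k)) (nb-old {w = w} c<)))
                                           (δ-weight (nb w) (suc k))))
                       (ℤ.+-comm (exactly k w) _))
  (exactly-CFinite k)

fewBlocks-CFinite : ∀ m → CFinite (total (𝟙 ∘ fewBlocks m))
fewBlocks-CFinite m = CFinite-cong (total-cong (λ {_} {w} _ → Σ-δ (nb w) m))
                                   (total-Σ exactly exactly-CFinite m)

isDiscrete isLump : LumpState → Bool
isDiscrete discrete = true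
isDiscrete _        = false
isLump (lump _) = true
isLump _        = false

discreteStat lumpStat linkStat : Statistic
discreteStat w = 𝟙 (isDiscrete (lumpState w))
lumpStat     w = 𝟙 (isLump (lumpState w))
linkStat     w = + nb w ℤ.* discreteStat w

≡ᵇ-refl : ∀ n → (n ≡ᵇ n) ≡ true
≡ᵇ-refl n = ≡ᵇ-true {n} refl

old≢new : ∀ {c k} → c ∈ˡ List.downFrom k → (c ≡ᵇ k) ≡ false
old≢new = ≡ᵇ-false ∘ <⇒≢ ∘ ∈-downFrom⁻

discreteStat-old : ∀ {n} (w : Vec ℕ n) {c} → c < nb w → discreteStat (c ∷ w) ≡ 0ℤ
discreteStat-old w {c} c< with lumpState w
... | discrete rewrite ≡ᵇ-false (<⇒≢ c<) = refl
... | lump b with c ≡ᵇ b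
...   | true  = refl
...   | false = refl
discreteStat-old w {c} c< | bad = refl

discreteStat-new : ∀ {n} (w : Vec ℕ n) → RGF w → discreteStat (nb w ∷ w) ≡ discreteStat w
discreteStat-new w r with lumpState w
... | discrete rewrite ≡ᵇ-refl (nb w) = refl
... | lump b with nb w ≡ᵇ b
...   | true  = refl
...   | false = refl
discreteStat-new w r | bad = refl

discreteStat-CFinite : CFinite (total discreteStat)
discreteStat-CFinite = total-CFinite discreteStat (λ _ → 0ℤ) 1ℤ
  (λ {_} {w} r → cong₂ ℤ._+_ (trans (discreteStat-new w r) (sym (ℤ.*-identityˡ _)))
                             (Σ-zero (List.downFrom (nb w)) (discreteStat-old w ∘ ∈-downFrom⁻)))
  (total-zero (λ _ → 0ℤ) (λ _ → refl))

-- Any of the `nb w` letters of a discrete word can be the one repeated. This weight varies with w,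
-- so it becomes a statistic of its own; a fresh letter raises `nb` by one, whence the extra
-- `discreteStat`.
linkStat-CFinite : CFinite (total linkStat)
linkStat-CFinite = total-CFinite linkStat discreteStat 1ℤ
  (λ {_} {w} r → trans (cong₂ ℤ._+_
      (cong₂ (λ k x → + k ℤ.* x) (nb-new w) (discreteStat-new w r))
      (Σ-zero (List.downFrom (nb w)) λ {c} c∈ →
        trans (cong (λ x → + nb (c ∷ w) ℤ.* x) (discreteStat-old w (∈-downFrom⁻ c∈))) (ℤ.*-zeroʳ (+ nb (c ∷ w)))))
    (expand (+ nb w) (discreteStat w)))
  discreteStat-CFinite
  where
  expand : ∀ k x → (1ℤ ℤ.+ k) ℤ.* x ℤ.+ 0ℤ ≡ 1ℤ ℤ.* (k ℤ.* x) ℤ.+ x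
  expand = solve-∀

lumpStat-transfer : ∀ {n} {w : Vec ℕ n} → RGF w → transfer lumpStat w ≡ 1ℤ ℤ.* lumpStat w ℤ.+ linkStat w
lumpStat-transfer {w = w} r with lumpState w | lumpInvariant r
... | discrete | _ rewrite ≡ᵇ-refl (nb w) = cong (λ s → 0ℤ ℤ.+ s)
      (Σ-const (nb w) λ {c} c< → cong (λ b → 𝟙 (isLump (if b then discrete else lump c))) (≡ᵇ-false (<⇒≢ c<)))
... | lump b | bb , _ rewrite ℤ.*-zeroʳ (+ nb w) =
      trans (Σ-cong (List.downFrom (suc (nb w))) (λ {c} _ → isLump-if (c ≡ᵇ b)))
            (Σ-δ₁ (m<n⇒m<1+n (head<nb bb)))
  where
  isLump-if : ∀ t → 𝟙 (isLump (if t then lump b else bad)) ≡ 𝟙 t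
  isLump-if true  = refl
  isLump-if false = refl
... | bad | _ rewrite ℤ.*-zeroʳ (+ nb w) = Σ-zero (List.downFrom (suc (nb w))) (λ _ → refl)

lumpFree-CFinite : CFinite (total (𝟙 ∘ lumpFree))
lumpFree-CFinite = CFinite-cong (total-cong {λ w → discreteStat w ℤ.+ lumpStat w}
    (λ {_} {w} _ → split (lumpState w)))
  (total-+ discreteStat lumpStat discreteStat-CFinite
    (total-CFinite lumpStat linkStat 1ℤ lumpStat-transfer linkStat-CFinite))
  where
  split : ∀ s → 𝟙 (isDiscrete s) ℤ.+ 𝟙 (isLump s) ≡ 𝟙 (notBad s)
  split discrete = refl
  split (lump _) = refl
  split bad      = refl

emptyStat : Statistic
emptyStat []      = 1ℤ
emptyStat (_ ∷ _) = 0ℤ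

emptyStat-CFinite : CFinite (total emptyStat)
emptyStat-CFinite = total-CFinite emptyStat (λ _ → 0ℤ) 0ℤ
  (λ {_} {w} _ → Σ-zero (List.downFrom (suc (nb w))) (λ _ → refl))
  (total-zero (λ _ → 0ℤ) (λ _ → refl))

-- A nonempty interval partition has two extensions and the empty one has only one; `emptyStat`
-- corrects the difference.
layered-transfer : ∀ {n} {w : Vec ℕ n} → RGF w →
  transfer (𝟙 ∘ layered) w ≡ + 2 ℤ.* 𝟙 (layered w) ℤ.+ -1ℤ ℤ.* emptyStat w
layered-transfer []      = refl
layered-transfer {w = d ∷ w} r with layered (d ∷ w)
... | false = Σ-zero (List.downFrom (suc (nb (d ∷ w)))) (λ _ → refl)
... | true  = cong₂ ℤ._+_
  (cong 𝟙 (trans (cong ((nb (d ∷ w) ≡ᵇ d) ∨_) (≡ᵇ-refl (nb (d ∷ w)))) (∨-zeroʳ _)))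
  (trans (Σ-cong (List.downFrom (nb (d ∷ w))) λ {c} c∈ →
            cong 𝟙 (trans (cong ((c ≡ᵇ d) ∨_) (old≢new c∈)) (∨-identityʳ (c ≡ᵇ d))))
         (Σ-δ₁ (lookup<nb (d ∷ w) zero)))

layered-CFinite : CFinite (total (𝟙 ∘ layered))
layered-CFinite = total-CFinite (𝟙 ∘ layered) (λ w → -1ℤ ℤ.* emptyStat w) (+ 2) layered-transfer
  (total-* -1ℤ emptyStat emptyStat-CFinite)

-- A suffix that contains the letter c has `nb` at least c + 1. Hence only labels below N can be
-- joinable, and `#joinable` may count over N labels however many blocks there are.
joinable-bounded : ∀ {N n} (w : Vec ℕ n) {c} → N ≤ c → joinable N w c ≡ false
joinable-bounded []      N≤c = refl
joinable-bounded (d ∷ w) {c} N≤c with d ≡ᵇ c in eq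
... | false = joinable-bounded w N≤c
... | true with ≡ᵇ-true⁻ {d} eq
...   | refl = <ᵇ-false (≤-trans (s≤s N≤c) (m≤m⊔n (suc c) (nb w)))

joinable-full : ∀ {N n} {w : Vec ℕ n} → RGF w → nb w ≤ N → ∀ {c} → c < nb w → joinable N w c ≡ true
joinable-full {N} {w = w} r nb≤ {c} c< with joinable N w c in eq
... | true  = refl
... | false with to (joinable-false {N} r c<) eq
...   | u , p , D = contradiction (Distinct-≤ D (⊑-bounded p)) (≤⇒≯ nb≤)

pairFree-full : ∀ {N n} {w : Vec ℕ n} → RGF w → nb w ≤ N → pairFree N w ≡ true
pairFree-full []                      nb≤ = refl
pairFree-full {N} {w = c ∷ w} (c≤ ∷ r) nb≤
  with ≤-trans (m≤n⊔m (suc c) (nb w)) nb≤ | m≤n⇒m<n∨m≡n c≤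
... | nb≤′ | inj₁ c<   = cong₂ _∧_ (pairFree-full r nb≤′)
                          (trans (cong ((c ≡ᵇ nb w) ∨_) (joinable-full r nb≤′ c<)) (∨-zeroʳ _))
... | nb≤′ | inj₂ refl = cong₂ _∧_ (pairFree-full r nb≤′) (cong (_∨ joinable N w c) (≡ᵇ-refl c))

count : (ℕ → Bool) → ℕ → ℕ
count p k = length (List.filter (T? ∘ p) (List.downFrom k))

count-Σ : ∀ p k → + count p k ≡ Σ[ List.downFrom k ] (𝟙 ∘ p)
count-Σ p k = length-filter p (List.downFrom k)

count-≤ : ∀ p k → count p k ≤ k
count-≤ p k = subst (count p k ≤_) (List.length-downFrom k) (List.length-filter (T? ∘ p) (List.downFrom k))

count-cong : ∀ {p q} k → (∀ {b} → b < k → p b ≡ q b) → count p k ≡ count q k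
count-cong {p} {q} k e = ℤ.+-injective (trans (count-Σ p k)
  (trans (Σ-cong (List.downFrom k) (λ b∈ → cong 𝟙 (e (∈-downFrom⁻ b∈)))) (sym (count-Σ q k))))

count-full : ∀ {p} k → (∀ {b} → b < k → p b ≡ true) → count p k ≡ k
count-full {p} k e = ℤ.+-injective (trans (count-Σ p k)
  (trans (Σ-const k (λ b< → cong 𝟙 (e b<))) (ℤ.*-identityʳ (+ k))))

count-remove : ∀ {p c} k → c < k → p c ≡ true →
               suc (count (λ b → if c ≡ᵇ b then false else p b) k) ≡ count p k
count-remove {p} {c} k c<k pc = ℤ.+-injective (trans
  (cong₂ ℤ._+_ (sym (trans (Σ-δ c k) (cong 𝟙 (<ᵇ-true c<k)))) (count-Σ _ k))
  (trans (sym (Σ-+ (List.downFrom k) _ _))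
  (trans (Σ-cong (List.downFrom k) (λ {b} _ → remove b)) (sym (count-Σ p k)))))
  where
  remove : ∀ b → 𝟙 (c ≡ᵇ b) ℤ.+ 𝟙 (if c ≡ᵇ b then false else p b) ≡ 𝟙 (p b)
  remove b with c ≡ᵇ b in eq
  ... | false = ℤ.+-identityˡ _
  ... | true  = cong 𝟙 (sym (trans (cong p (sym (≡ᵇ-true⁻ {c} eq))) pc))

count-extend : ∀ p k j → k ≤ j → (∀ {b} → k ≤ b → p b ≡ false) → count p j ≡ count p k
count-extend p k zero    z≤n   e = refl
count-extend p k (suc j) k≤ e with m≤n⇒m<n∨m≡n k≤
... | inj₂ refl = refl
... | inj₁ k<   = ℤ.+-injective (trans (count-Σ p (suc j)) (trans
        (cong₂ ℤ._+_ (cong 𝟙 (e (≤-pred k<)))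
          (trans (sym (count-Σ p j)) (cong +_ (count-extend p k j (≤-pred k<) e))))
        (ℤ.+-identityˡ _)))

#joinable : ℕ → ∀ {n} → Vec ℕ n → ℕ
#joinable N w = count (joinable N w) N

-- With more than N blocks present, an element just added has N blocks other than its own above it.
-- So a joined block never becomes joinable again and a new block never is; the number a of joinable
-- blocks is all that the future depends on.
crowded : ℕ → ℕ → Statistic
crowded N a w = 𝟙 (pairFree N w ∧ ((N <ᵇ nb w) ∧ (#joinable N w ≡ᵇ a)))

crowded-few : ∀ N a {n} (w : Vec ℕ n) → nb w ≤ N → crowded N a w ≡ 0ℤ
crowded-few N a w nb≤ = cong 𝟙 (trans
  (cong (λ b → pairFree N w ∧ (b ∧ (#joinable N w ≡ᵇ a))) (<ᵇ-false {N} nb≤)) (∧-zeroʳ _))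

#joinable-new : ∀ N {n} (w : Vec ℕ n) → N ≤ nb w → #joinable N (nb w ∷ w) ≡ #joinable N w
#joinable-new N w N≤ = count-cong N λ {b} b< →
  cong (λ t → if t then (nb (nb w ∷ w) <ᵇ suc N) else joinable N w b)
       (≡ᵇ-false (λ e → <⇒≢ (<-≤-trans b< N≤) (sym e)))

-- Joining c moves its minimum to a place with more than N blocks, and no other block is affected.
-- Being joinable, c has a label below N, so it was among those counted.
#joinable-old : ∀ N {n} (w : Vec ℕ n) → N < nb w → ∀ {c} → c < nb w → joinable N w c ≡ true →
                suc (#joinable N (c ∷ w)) ≡ #joinable N w
#joinable-old N w N< {c} c< jc = trans
  (cong suc (count-cong N (λ {b} _ → cong (λ t → if c ≡ᵇ b then t else joinable N w b)
     (<ᵇ-false (subst (suc N ≤_) (sym (nb-old {w = w} c<)) N<)))))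
  (count-remove N c<N jc)
  where
  c<N : c < N
  c<N with c <? N
  ... | yes c<N = c<N
  ... | no c≮N with trans (sym jc) (joinable-bounded w (≮⇒≥ c≮N))
  ...   | ()

zeros : ∀ x y → 0ℤ ≡ 1ℤ ℤ.* 0ℤ ℤ.+ (x ℤ.* 0ℤ ℤ.+ y ℤ.* 0ℤ)
zeros = solve-∀

crowded-new-nb : ∀ N a {n} (w : Vec ℕ n) → N ≤ nb w →
  crowded N a (nb w ∷ w) ≡ 𝟙 (pairFree N w ∧ (#joinable N w ≡ᵇ a))
crowded-new-nb N a w N≤ = cong 𝟙 (cong₂ _∧_
  (trans (cong (λ t → pairFree N w ∧ (t ∨ joinable N w (nb w))) (≡ᵇ-refl (nb w))) (∧-identityʳ _))
  (cong₂ _∧_ (<ᵇ-true (subst (N <_) (sym (nb-new w)) (s≤s N≤)))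
             (cong (_≡ᵇ a) (#joinable-new N w N≤))))

crowded-many : ∀ N a {n} (w : Vec ℕ n) → N < nb w → crowded N a w ≡ 𝟙 (pairFree N w ∧ (#joinable N w ≡ᵇ a))
crowded-many N a w N< = cong (λ t → 𝟙 (pairFree N w ∧ (t ∧ (#joinable N w ≡ᵇ a)))) (<ᵇ-true N<)

crowded-old : ∀ N a {n} (w : Vec ℕ n) → N < nb w → pairFree N w ≡ true → ∀ {c} → c < nb w →
  crowded N a (c ∷ w) ≡ 𝟙 (#joinable N w ≡ᵇ suc a) ℤ.* 𝟙 (joinable N w c)
crowded-old N a w N< pf {c} c< = trans
  (crowded-many N a (c ∷ w) (subst (N <_) (sym (nb-old {w = w} c<)) N<))
  (trans (cong (λ t → 𝟙 (t ∧ (#joinable N (c ∷ w) ≡ᵇ a)))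
           (cong₂ _∧_ pf (cong (_∨ joinable N w c) (≡ᵇ-false (<⇒≢ c<)))))
         (branch (joinable N w c) refl))
  where
  branch : ∀ b → joinable N w c ≡ b →
           𝟙 (b ∧ (#joinable N (c ∷ w) ≡ᵇ a)) ≡ 𝟙 (#joinable N w ≡ᵇ suc a) ℤ.* 𝟙 b
  branch false jc = sym (ℤ.*-zeroʳ (𝟙 (#joinable N w ≡ᵇ suc a)))
  branch true  jc = trans (cong (λ k → 𝟙 (k ≡ᵇ suc a)) (#joinable-old N w N< c< jc))
                          (sym (ℤ.*-identityʳ _))

crowded-bad : ∀ N a {n} (w : Vec ℕ n) → pairFree N w ≡ false → crowded N a w ≡ 0ℤ
crowded-bad N a w pf = cong (λ t → 𝟙 (t ∧ ((N <ᵇ nb w) ∧ (#joinable N w ≡ᵇ a)))) pf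

exactly-false : ∀ {k n} (w : Vec ℕ n) → nb w ≢ k → exactly k w ≡ 0ℤ
exactly-false w ≢k = cong 𝟙 (≡ᵇ-false ≢k)

-- The two ways into level a from elsewhere: joining one of the a + 1 joinable blocks at level a +
-- 1, or opening a further block when there are exactly N. In the second case all N old blocks are
-- joinable, so entry is at a = N. Opening a block within level a is the diagonal coefficient 1.
crowdedNext : ℕ → ℕ → Statistic
crowdedNext N a w = + suc a ℤ.* crowded N (suc a) w ℤ.+ 𝟙 (N ≡ᵇ a) ℤ.* exactly N w

crowded-values : ∀ N a {n} (w : Vec ℕ n) {x y e} →
  crowded N a w ≡ x → crowded N (suc a) w ≡ y → exactly N w ≡ e →
  1ℤ ℤ.* x ℤ.+ (+ suc a ℤ.* y ℤ.+ 𝟙 (N ≡ᵇ a) ℤ.* e) ≡ 1ℤ ℤ.* crowded N a w ℤ.+ crowdedNext N a w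
crowded-values N a w p q r = sym (cong₂ (λ x y → 1ℤ ℤ.* x ℤ.+ y) p
  (cong₂ (λ y e → + suc a ℤ.* y ℤ.+ 𝟙 (N ≡ᵇ a) ℤ.* e) q r))

crowded-transfer-few : ∀ N a {n} (w : Vec ℕ n) → nb w < N →
  transfer (crowded N a) w ≡ 1ℤ ℤ.* crowded N a w ℤ.+ crowdedNext N a w
crowded-transfer-few N a w nb< =
    trans (Σ-zero (List.downFrom (suc (nb w))) λ {c} c∈ →
             crowded-few N a (c ∷ w) (⊔-lub (≤-trans (∈-downFrom⁻ c∈) nb<) (<⇒≤ nb<)))
          (trans (zeros (+ suc a) (𝟙 (N ≡ᵇ a)))
            (crowded-values N a w (crowded-few N a w (<⇒≤ nb<)) (crowded-few N (suc a) w (<⇒≤ nb<))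
                                  (exactly-false w (<⇒≢ nb<))))

crowded-transfer-full : ∀ a {n} {w : Vec ℕ n} → RGF w → let N = nb w in
  transfer (crowded N a) w ≡ 1ℤ ℤ.* crowded N a w ℤ.+ crowdedNext N a w
crowded-transfer-full a {w = w} r
  = trans (cong₂ ℤ._+_
            (trans (crowded-new-nb N a w ≤-refl)
              (cong 𝟙 (cong₂ _∧_ (pairFree-full r ≤-refl)
                               (cong (_≡ᵇ a) (count-full N (joinable-full r ≤-refl))))))
            (Σ-zero (List.downFrom N) λ {c} c∈ →
              crowded-few N a (c ∷ w) (≤-reflexive (nb-old {w = w} (∈-downFrom⁻ c∈)))))
          (trans (simplify (+ suc a) (𝟙 (N ≡ᵇ a)))
            (crowded-values N a w (crowded-few N a w ≤-refl) (crowded-few N (suc a) w ≤-refl)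
                                  (cong 𝟙 (≡ᵇ-refl N))))
  where
  N = nb w
  simplify : ∀ x y → y ℤ.+ 0ℤ ≡ 1ℤ ℤ.* 0ℤ ℤ.+ (x ℤ.* 0ℤ ℤ.+ y ℤ.* 1ℤ)
  simplify = solve-∀

crowded-transfer-many : ∀ N a {n} (w : Vec ℕ n) → N < nb w → ∀ b → pairFree N w ≡ b →
  transfer (crowded N a) w ≡ 1ℤ ℤ.* crowded N a w ℤ.+ crowdedNext N a w
crowded-transfer-many N a w N< false pf =
    trans (Σ-zero (List.downFrom (suc (nb w))) λ {c} _ → crowded-bad N a (c ∷ w) (∧-falseˡ pf))
          (trans (zeros (+ suc a) (𝟙 (N ≡ᵇ a)))
            (crowded-values N a w (crowded-bad N a w pf) (crowded-bad N (suc a) w pf)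
                                  (exactly-false w (<⇒≢ N< ∘ sym))))
crowded-transfer-many N a w N< true pf =
    trans (cong₂ ℤ._+_
            (trans (crowded-new-nb N a w (<⇒≤ N<)) (cong (λ t → 𝟙 (t ∧ (j ≡ᵇ a))) pf))
            (begin
              Σ[ List.downFrom (nb w) ] (λ c → crowded N a (c ∷ w))
                ≡⟨ Σ-cong (List.downFrom (nb w)) (λ c∈ → crowded-old N a w N< pf (∈-downFrom⁻ c∈)) ⟩
              Σ[ List.downFrom (nb w) ] (λ c → 𝟙 (j ≡ᵇ suc a) ℤ.* 𝟙 (joinable N w c))
                ≡⟨ Σ-* (𝟙 (j ≡ᵇ suc a)) (List.downFrom (nb w)) (𝟙 ∘ joinable N w) ⟩
              𝟙 (j ≡ᵇ suc a) ℤ.* Σ[ List.downFrom (nb w) ] (𝟙 ∘ joinable N w)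
                ≡⟨ cong (λ s → 𝟙 (j ≡ᵇ suc a) ℤ.* s) (trans (sym (count-Σ (joinable N w) (nb w)))
                     (cong +_ (count-extend (joinable N w) N (nb w) (<⇒≤ N<) (joinable-bounded w)))) ⟩
              𝟙 (j ≡ᵇ suc a) ℤ.* + j
                ≡⟨ ℤ.*-comm (𝟙 (j ≡ᵇ suc a)) (+ j) ⟩
              + j ℤ.* 𝟙 (j ≡ᵇ suc a)
                ≡⟨ δ-weight j (suc a) ⟩
              + suc a ℤ.* 𝟙 (j ≡ᵇ suc a) ∎))
          (trans (simplify (𝟙 (j ≡ᵇ a)) (+ suc a ℤ.* 𝟙 (j ≡ᵇ suc a)) (𝟙 (N ≡ᵇ a)))
            (crowded-values N a w (value a) (value (suc a)) (exactly-false w (<⇒≢ N< ∘ sym))))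
  where
  open ≡-Reasoning
  j = #joinable N w
  value : ∀ a → crowded N a w ≡ 𝟙 (j ≡ᵇ a)
  value a = trans (crowded-many N a w N<) (cong (λ t → 𝟙 (t ∧ (j ≡ᵇ a))) pf)
  simplify : ∀ x y z → x ℤ.+ y ≡ 1ℤ ℤ.* x ℤ.+ (y ℤ.+ z ℤ.* 0ℤ)
  simplify = solve-∀

crowded-transfer : ∀ N a {n} {w : Vec ℕ n} → RGF w →
  transfer (crowded N a) w ≡ 1ℤ ℤ.* crowded N a w ℤ.+ crowdedNext N a w
crowded-transfer N a {w = w} r with <-cmp N (nb w)
... | tri< N< _ _   = crowded-transfer-many N a w N< (pairFree N w) refl
... | tri≈ _ refl _ = crowded-transfer-full a r
... | tri> _ _ nb<  = crowded-transfer-few N a w nb<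

-- The system is triangular upwards: level a needs level a + 1, and levels above N are empty because
-- at most N blocks are joinable. The number k bounds the steps left to get there.
crowded-CFinite : ∀ N k a → N < k ℕ.+ a → CFinite (total (crowded N a))
crowded-CFinite N zero a N<a = total-zero (crowded N a) λ {_} {w} _ → cong 𝟙 (trans
  (cong (λ t → pairFree N w ∧ ((N <ᵇ nb w) ∧ t))
        (≡ᵇ-false (<⇒≢ (≤-<-trans (count-≤ (joinable N w) N) N<a))))
  (trans (cong (pairFree N w ∧_) (∧-zeroʳ _)) (∧-zeroʳ _)))
crowded-CFinite N (suc k) a N< = total-CFinite (crowded N a) (crowdedNext N a) 1ℤ (crowded-transfer N a)
  (total-+ (λ w → + suc a ℤ.* crowded N (suc a) w) (λ w → 𝟙 (N ≡ᵇ a) ℤ.* exactly N w)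
    (total-* (+ suc a) (crowded N (suc a))
      (crowded-CFinite N k (suc a) (subst (N <_) (sym (ℕ.+-suc k a)) N<)))
    (total-* (𝟙 (N ≡ᵇ a)) (exactly N) (exactly-CFinite N)))

-- Words with at most N blocks have too few letters for the pattern and all count; the remaining
-- ones are sorted by their number of joinable blocks, from 0 to N.
pairFree-CFinite : ∀ N → CFinite (total (𝟙 ∘ pairFree N))
pairFree-CFinite N = CFinite-cong (total-cong {λ w → 𝟙 (fewBlocks (suc N) w) ℤ.+ levels w} split)
  (total-+ (𝟙 ∘ fewBlocks (suc N)) levels (fewBlocks-CFinite (suc N))
    (total-Σ (crowded N) (λ a → crowded-CFinite N (suc N) a (m≤m+n (suc N) a)) (suc N)))
  where
  levels : Statistic
  levels w = Σ[ List.downFrom (suc N) ] (λ a → crowded N a w)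
  split : ∀ {n} {w : Vec ℕ n} → RGF w → 𝟙 (fewBlocks (suc N) w) ℤ.+ levels w ≡ 𝟙 (pairFree N w)
  split {w = w} r with N <? nb w
  ... | no N≮ = trans (cong₂ ℤ._+_ (cong 𝟙 (<ᵇ-true (s≤s (≮⇒≥ N≮))))
          (Σ-zero (List.downFrom (suc N)) (λ {a} _ → crowded-few N a w (≮⇒≥ N≮))))
          (cong 𝟙 (sym (pairFree-full r (≮⇒≥ N≮))))
  ... | yes N< = trans (cong₂ ℤ._+_ (cong 𝟙 (<ᵇ-false {nb w} {suc N} N<))
          (trans (Σ-cong (List.downFrom (suc N)) (λ {a} _ → crowded-many N a w N<)) (sumδ (pairFree N w))))
          (ℤ.+-identityˡ _)
    where
    sumδ : ∀ b → Σ[ List.downFrom (suc N) ] (λ a → 𝟙 (b ∧ (#joinable N w ≡ᵇ a))) ≡ 𝟙 b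
    sumδ false = Σ-zero (List.downFrom (suc N)) (λ _ → refl)
    sumδ true  = trans (Σ-δ (#joinable N w) (suc N)) (cong 𝟙 (<ᵇ-true (s≤s (count-≤ (joinable N w) N))))

-- Partitions with small blocks

-- A block of size z + 1 is recorded as z, so that the record of a new block is 0.

bump : ℕ → List ℕ → List ℕ
bump c       []       = 0 ∷ []
bump zero    (z ∷ zs) = suc z ∷ zs
bump (suc c) (z ∷ zs) = z ∷ bump c zs

sizes : ∀ {n} → Vec ℕ n → List ℕ
sizes []      = []
sizes (c ∷ w) = bump c (sizes w)

sizeAt : List ℕ → ℕ → ℕ
sizeAt []       a       = 0
sizeAt (z ∷ zs) zero    = suc z
sizeAt (z ∷ zs) (suc a) = sizeAt zs a

length-bump-old : ∀ {c} zs → c < length zs → length (bump c zs) ≡ length zs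
length-bump-old {zero}  (z ∷ zs) c<       = refl
length-bump-old {suc c} (z ∷ zs) (s≤s c<) = cong suc (length-bump-old zs c<)

length-bump-new : ∀ zs → length (bump (length zs) zs) ≡ suc (length zs)
length-bump-new []       = refl
length-bump-new (z ∷ zs) = cong suc (length-bump-new zs)

length-sizes : ∀ {n} {w : Vec ℕ n} → RGF w → length (sizes w) ≡ nb w
length-sizes []                     = refl
length-sizes {w = c ∷ w} (c≤ ∷ r) with m≤n⇒m<n∨m≡n c≤
... | inj₁ c<   = trans (length-bump-old (sizes w) (subst (c <_) (sym (length-sizes r)) c<))
                        (trans (length-sizes r) (sym (nb-old {w = w} c<)))
... | inj₂ refl = trans (cong (λ k → length (bump k (sizes w))) (sym (length-sizes r)))
                 (trans (length-bump-new (sizes w)) (trans (cong suc (length-sizes r)) (sym (nb-new w))))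

sizeAt-bump-same : ∀ c zs → c ≤ length zs → sizeAt (bump c zs) c ≡ suc (sizeAt zs c)
sizeAt-bump-same zero    []       c≤       = refl
sizeAt-bump-same zero    (z ∷ zs) c≤       = refl
sizeAt-bump-same (suc c) (z ∷ zs) (s≤s c≤) = sizeAt-bump-same c zs c≤

sizeAt-bump-other : ∀ c a zs → c ≤ length zs → c ≢ a → sizeAt (bump c zs) a ≡ sizeAt zs a
sizeAt-bump-other zero    zero    zs       c≤       c≢a = contradiction refl c≢a
sizeAt-bump-other zero    (suc a) []       c≤       c≢a = refl
sizeAt-bump-other zero    (suc a) (z ∷ zs) c≤       c≢a = refl
sizeAt-bump-other (suc c) zero    (z ∷ zs) c≤       c≢a = refl
sizeAt-bump-other (suc c) (suc a) (z ∷ zs) (s≤s c≤) c≢a = sizeAt-bump-other c a zs c≤ (c≢a ∘ cong suc)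

replicate-⊑ : ∀ {n} {w : Vec ℕ n} → RGF w → ∀ k {a} → (Vec.replicate k a ⊑ w) ⇔ (k ≤ sizeAt (sizes w) a)
replicate-⊑ r k = mk⇔ (f r k) (g r k)
  where
  c≤length : ∀ {n c} {w : Vec ℕ n} → RGF w → c ≤ nb w → c ≤ length (sizes w)
  c≤length r = subst (_ ≤_) (sym (length-sizes r))
  f : ∀ {n} {w : Vec ℕ n} → RGF w → ∀ k {a} → Vec.replicate k a ⊑ w → k ≤ sizeAt (sizes w) a
  f r zero p = z≤n
  f {w = c ∷ w} (c≤ ∷ r) (suc k) (keep p) =
    subst (suc k ≤_) (sym (sizeAt-bump-same c (sizes w) (c≤length r c≤))) (s≤s (f r k p))
  f {w = c ∷ w} (c≤ ∷ r) (suc k) {a} (skip p) with c ℕ.≟ a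
  ... | yes refl = subst (suc k ≤_) (sym (sizeAt-bump-same c (sizes w) (c≤length r c≤)))
                         (m≤n⇒m≤1+n (f r (suc k) p))
  ... | no c≢a   = subst (suc k ≤_) (sym (sizeAt-bump-other c a (sizes w) (c≤length r c≤) c≢a))
                         (f r (suc k) p)
  g : ∀ {n} {w : Vec ℕ n} → RGF w → ∀ k {a} → k ≤ sizeAt (sizes w) a → Vec.replicate k a ⊑ w
  g r zero k≤ = []⊑ _
  g {w = c ∷ w} (c≤ ∷ r) (suc k) {a} k≤ with c ℕ.≟ a
  ... | yes refl = keep (g r k (≤-pred (subst (suc k ≤_) (sizeAt-bump-same c (sizes w) (c≤length r c≤)) k≤)))
  ... | no c≢a   = skip (g r (suc k)
                         (subst (suc k ≤_) (sizeAt-bump-other c a (sizes w) (c≤length r c≤) c≢a) k≤))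

allBelow : ℕ → List ℕ → Bool
allBelow M []       = true
allBelow M (z ∷ zs) = (z <ᵇ M) ∧ allBelow M zs

allBelow-false : ∀ M zs → (allBelow M zs ≡ false) ⇔ (∃ λ a → suc M ≤ sizeAt zs a)
allBelow-false M []       = mk⇔ (λ ()) (λ ())
allBelow-false M (z ∷ zs) with z <ᵇ M in eq
... | false = mk⇔ (λ _ → zero , s≤s (<ᵇ-false⁻ eq)) (λ _ → refl)
... | true  = mk⇔ (λ e → let a , p = to (allBelow-false M zs) e in suc a , p)
  λ { (zero , s≤s p) → contradiction (trans (sym (<ᵇ-false {z} p)) eq) λ ()
    ; (suc a , p) → from (allBelow-false M zs) (a , p) }

smallBlocks : ℕ → ∀ {n} → Vec ℕ n → Bool
smallBlocks M w = allBelow M (sizes w)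

constant⇒replicate : ∀ {k a} (v : Vec ℕ k) → (∀ i → lookup v i ≡ a) → v ≡ Vec.replicate k a
constant⇒replicate []      e = refl
constant⇒replicate (c ∷ v) e = cong₂ _∷_ (e zero) (constant⇒replicate v (e ∘ suc))

smallBlocks-decides : ∀ {M} (π : Partition (suc M)) → (∀ i j → SameBlock (blocks π) i j) →
                      smallBlocks M Decides π
smallBlocks-decides {M} π all {w = w} r = mk⇔
  (λ eq → let a , p = to (allBelow-false M (sizes w)) eq in
          Vec.replicate (suc M) a , from (replicate-⊑ r (suc M)) p ,
          λ i j → mk⇔ (λ _ → all i j) (λ _ → trans (Vec.lookup-replicate i a) (sym (Vec.lookup-replicate j a))))
  (λ (v , v⊑ , μ) → from (allBelow-false M (sizes w)) (lookup v zero , to (replicate-⊑ r (suc M))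
     (subst (_⊑ w) (constant⇒replicate v (λ i → from (μ i zero) (all i zero))) v⊑)))

-- The transfer operator for statistics that see only block sizes, with `length zs` in the place of
-- `nb w`.
grow : (List ℕ → ℤ) → List ℕ → ℤ
grow G zs = Σ[ List.downFrom (suc (length zs)) ] (λ c → G (bump c zs))

sizeTotal : ℕ → (List ℕ → ℤ) → ℤ
sizeTotal zero    G = G []
sizeTotal (suc n) G = sizeTotal n (grow G)

sizeTotal-cong : ∀ n {F G} → (∀ zs → F zs ≡ G zs) → sizeTotal n F ≡ sizeTotal n G
sizeTotal-cong zero    e = e []
sizeTotal-cong (suc n) e = sizeTotal-cong n λ zs →
  Σ-cong (List.downFrom (suc (length zs))) (λ {c} _ → e (bump c zs))

-- After one step every list reached is nonempty. The decompositions by the first block below hold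
-- only for nonempty lists, so agreement there has to suffice.
sizeTotal-cong⁺ : ∀ n F G → (∀ z zs → F (z ∷ zs) ≡ G (z ∷ zs)) → sizeTotal (suc n) F ≡ sizeTotal (suc n) G
sizeTotal-cong⁺ n F G e = sizeTotal-cong n λ zs →
  Σ-cong (List.downFrom (suc (length zs))) (λ {c} _ → at c zs)
  where
  at : ∀ c zs → F (bump c zs) ≡ G (bump c zs)
  at c       []       = e 0 []
  at zero    (z ∷ zs) = e (suc z) zs
  at (suc c) (z ∷ zs) = e z (bump c zs)

sizeTotal-+ : ∀ n F G → sizeTotal n (λ zs → F zs ℤ.+ G zs) ≡ sizeTotal n F ℤ.+ sizeTotal n G
sizeTotal-+ zero    F G = refl
sizeTotal-+ (suc n) F G = trans
  (sizeTotal-cong n λ zs → Σ-+ (List.downFrom (suc (length zs))) (λ c → F (bump c zs)) (λ c → G (bump c zs)))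
  (sizeTotal-+ n (grow F) (grow G))

sizeTotal-0 : ∀ n → sizeTotal n (λ _ → 0ℤ) ≡ 0ℤ
sizeTotal-0 zero    = refl
sizeTotal-0 (suc n) = trans
  (sizeTotal-cong n (λ zs → Σ-zero (List.downFrom (suc (length zs))) (λ _ → refl)))
  (sizeTotal-0 n)

sizeTotal-Σ : ∀ {A : Set} n (xs : List A) (F : A → List ℕ → ℤ) →
              sizeTotal n (λ zs → Σ[ xs ] (λ x → F x zs)) ≡ Σ[ xs ] (λ x → sizeTotal n (F x))
sizeTotal-Σ n []       F = sizeTotal-0 n
sizeTotal-Σ n (x ∷ xs) F =
  trans (sizeTotal-+ n (F x) _) (cong (λ s → sizeTotal n (F x) ℤ.+ s) (sizeTotal-Σ n xs F))

total-sizes : ∀ (G : List ℕ → ℤ) n → total (λ w → G (sizes w)) n ≡ sizeTotal n G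
total-sizes G zero    = ℤ.+-identityʳ (G [])
total-sizes G (suc n) = trans (total-suc (λ w → G (sizes w)) n)
  (trans (total-cong (λ {_} {w} r →
            cong (λ k → Σ[ List.downFrom (suc k) ] (λ c → G (bump c (sizes w)))) (sym (length-sizes r))) n)
         (total-sizes (grow G) n))

Σ-downFrom-suc : ∀ k f → Σ[ List.downFrom (suc k) ] f ≡ f 0 ℤ.+ Σ[ List.downFrom k ] (f ∘ suc)
Σ-downFrom-suc zero    f = refl
Σ-downFrom-suc (suc k) f = trans (cong (λ s → f (suc k) ℤ.+ s) (Σ-downFrom-suc k f)) (swap (f (suc k)) (f 0) _)
  where
  swap : ∀ x y z → x ℤ.+ (y ℤ.+ z) ≡ y ℤ.+ (x ℤ.+ z)
  swap = solve-∀

-- The head of a size list belongs to the letter 0, that is, to the block of the largest element;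
-- its i is the number of companions of that element.
firstBlock : ℕ → (List ℕ → ℤ) → List ℕ → ℤ
firstBlock i G []       = 0ℤ
firstBlock i G (z ∷ zs) = 𝟙 (z ≡ᵇ i) ℤ.* G zs

grow-firstBlock : ∀ i G z zs → grow (firstBlock i G) (z ∷ zs) ≡
  𝟙 (suc z ≡ᵇ i) ℤ.* G zs ℤ.+ firstBlock i (grow G) (z ∷ zs)
grow-firstBlock i G z zs = trans (Σ-downFrom-suc (suc (length zs)) (λ c → firstBlock i G (bump c (z ∷ zs))))
  (cong (λ s → 𝟙 (suc z ≡ᵇ i) ℤ.* G zs ℤ.+ s)
        (Σ-* (𝟙 (z ≡ᵇ i)) (List.downFrom (suc (length zs))) (λ c → G (bump c zs))))

nC0≡1 : ∀ n → n C 0 ≡ 1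
nC0≡1 n = trans (nCk≡nC[n∸k] {n = n} z≤n) (nCn≡1 n)

-- Following the block of the largest element: every other element either joins
-- it or extends the partition formed by the remaining elements.

sizeTotal-firstBlock : ∀ n i G →
  sizeTotal (suc n) (firstBlock i G) ≡ + (n C i) ℤ.* sizeTotal (n ∸ i) G
sizeTotal-firstBlock zero zero    G = ℤ.+-identityʳ _
sizeTotal-firstBlock zero (suc i) G =
  trans (ℤ.+-identityʳ _) (cong (λ k → + k ℤ.* G []) (sym (k>n⇒nCk≡0 {0} {suc i} (s≤s z≤n))))
sizeTotal-firstBlock (suc n) zero G = trans
  (sizeTotal-cong⁺ n (grow (firstBlock 0 G)) (firstBlock 0 (grow G))
    (λ z zs → trans (grow-firstBlock 0 G z zs) (ℤ.+-identityˡ _)))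
  (trans (sizeTotal-firstBlock n 0 (grow G))
         (cong (λ k → + k ℤ.* sizeTotal n (grow G)) (trans (nC0≡1 n) (sym (nC0≡1 (suc n))))))
sizeTotal-firstBlock (suc n) (suc i) G = trans
  (sizeTotal-cong⁺ n (grow (firstBlock (suc i) G))
    (λ zs → firstBlock i G zs ℤ.+ firstBlock (suc i) (grow G) zs)
    (grow-firstBlock (suc i) G))
  (trans (sizeTotal-+ (suc n) (firstBlock i G) (firstBlock (suc i) (grow G)))
  (trans (cong₂ ℤ._+_ (sizeTotal-firstBlock n i G) (sizeTotal-firstBlock n (suc i) (grow G)))
  (trans (cong (λ s → + (n C i) ℤ.* sizeTotal (n ∸ i) G ℤ.+ s) last)
  (trans (sym (ℤ.*-distribʳ-+ (sizeTotal (n ∸ i) G) (+ (n C i)) (+ (n C suc i))))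
         (cong (λ k → + k ℤ.* sizeTotal (n ∸ i) G) (nCk+nC[k+1]≡[n+1]C[k+1] n i))))))
  where
  -- Truncated subtraction gives the right index only for i < n; otherwise the binomial coefficient
  -- vanishes.
  last : + (n C suc i) ℤ.* sizeTotal (suc (n ∸ suc i)) G ≡ + (n C suc i) ℤ.* sizeTotal (n ∸ i) G
  last with i <? n
  ... | yes i<n = cong (λ k → + (n C suc i) ℤ.* sizeTotal k G) (sym (+-∸-assoc 1 i<n))
  ... | no i≮n rewrite k>n⇒nCk≡0 {n} {suc i} (s≤s (≮⇒≥ i≮n)) = refl

smallBlocks-recurrence : ∀ M n → let a = total (𝟙 ∘ smallBlocks M) in
  a (suc n) ≡ Σ[ List.downFrom M ] (λ i → + (n C i) ℤ.* a (n ∸ i))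
smallBlocks-recurrence M n = trans (total-sizes G (suc n))
  (trans (sizeTotal-cong⁺ n G (λ zs → Σ[ List.downFrom M ] (λ i → firstBlock i G zs)) decompose)
  (trans (sizeTotal-Σ (suc n) (List.downFrom M) (λ i → firstBlock i G))
         (Σ-cong (List.downFrom M) λ {i} _ → trans (sizeTotal-firstBlock n i G)
            (cong (λ s → + (n C i) ℤ.* s) (sym (total-sizes G (n ∸ i)))))))
  where
  G : List ℕ → ℤ
  G = 𝟙 ∘ allBelow M
  𝟙-∧ : ∀ b c → 𝟙 (b ∧ c) ≡ 𝟙 c ℤ.* 𝟙 b
  𝟙-∧ false c = sym (ℤ.*-zeroʳ (𝟙 c))
  𝟙-∧ true  c = sym (ℤ.*-identityʳ (𝟙 c))
  decompose : ∀ z zs → G (z ∷ zs) ≡ Σ[ List.downFrom M ] (λ i → firstBlock i G (z ∷ zs))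
  decompose z zs = trans (𝟙-∧ (z <ᵇ M) (allBelow M zs))
    (trans (cong (λ s → G zs ℤ.* s) (sym (Σ-δ z M)))
    (trans (sym (Σ-* (G zs) (List.downFrom M) _))
           (Σ-cong (List.downFrom M) (λ {i} _ → ℤ.*-comm (G zs) (𝟙 (z ≡ᵇ i))))))

-- Binomial coefficients as polynomials and the recurrence with cleared denominators.

C-absorb : ∀ n k → suc k ℕ.* (n C suc k) ℕ.+ k ℕ.* (n C k) ≡ n ℕ.* (n C k)
C-absorb zero    zero    = refl
C-absorb zero    (suc k)
  rewrite k>n⇒nCk≡0 {0} {suc (suc k)} (s≤s z≤n) | k>n⇒nCk≡0 {0} {suc k} (s≤s z≤n) = collapse k
  where
  collapse : ∀ k → suc (suc k) ℕ.* 0 ℕ.+ suc k ℕ.* 0 ≡ 0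
  collapse = solveℕ-∀
C-absorb (suc n) zero rewrite nC1≡n (suc n) | nC0≡1 (suc n) = simplify n
  where
  simplify : ∀ n → 1 ℕ.* suc n ℕ.+ 0 ≡ suc n ℕ.* 1
  simplify = solveℕ-∀
-- This is the absorption identity (k+1) C(n, k+1) = (n - k) C(n, k) with the subtracted term moved
-- across. Pascal's rule reduces it to the instances k + 1 and k for n.
C-absorb (suc n) (suc k) = begin
  suc (suc k) ℕ.* (suc n C suc (suc k)) ℕ.+ suc k ℕ.* (suc n C suc k)
    ≡⟨ cong₂ (λ x y → suc (suc k) ℕ.* x ℕ.+ suc k ℕ.* y) (pascal (suc k)) (pascal k) ⟨
  suc (suc k) ℕ.* (b ℕ.+ (n C suc (suc k))) ℕ.+ suc k ℕ.* (a ℕ.+ b)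
    ≡⟨ regroup k a b (n C suc (suc k)) ⟩
  (suc (suc k) ℕ.* (n C suc (suc k)) ℕ.+ suc k ℕ.* b) ℕ.+ (suc k ℕ.* b ℕ.+ k ℕ.* a) ℕ.+ (a ℕ.+ b)
    ≡⟨ cong₂ (λ x y → x ℕ.+ y ℕ.+ (a ℕ.+ b)) (C-absorb n (suc k)) (C-absorb n k) ⟩
  n ℕ.* b ℕ.+ n ℕ.* a ℕ.+ (a ℕ.+ b)
    ≡⟨ collect n a b ⟩
  suc n ℕ.* (a ℕ.+ b)
    ≡⟨ cong (suc n ℕ.*_) (pascal k) ⟩
  suc n ℕ.* (suc n C suc k) ∎
  where
  open ≡-Reasoning
  a = (n C k)
  b = (n C suc k)
  pascal = nCk+nC[k+1]≡[n+1]C[k+1] n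
  regroup : ∀ k a b c → suc (suc k) ℕ.* (b ℕ.+ c) ℕ.+ suc k ℕ.* (a ℕ.+ b) ≡
                        (suc (suc k) ℕ.* c ℕ.+ suc k ℕ.* b) ℕ.+ (suc k ℕ.* b ℕ.+ k ℕ.* a) ℕ.+ (a ℕ.+ b)
  regroup = solveℕ-∀
  collect : ∀ n a b → n ℕ.* b ℕ.+ n ℕ.* a ℕ.+ (a ℕ.+ b) ≡ suc n ℕ.* (a ℕ.+ b)
  collect = solveℕ-∀

-- The polynomial k + (x + c) p.
timesLinear : ℤ → ℤ → Poly → Poly
timesLinear c k []      = k ∷ []
timesLinear c k (q ∷ p) = (k ℤ.+ c ℤ.* q) ∷ timesLinear c q p

eval-timesLinear : ∀ c k p x → eval (timesLinear c k p) x ≡ k ℤ.+ (x ℤ.+ c) ℤ.* eval p x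
eval-timesLinear c k []      x = base c k x
  where
  base : ∀ c k x → k ℤ.+ x ℤ.* 0ℤ ≡ k ℤ.+ (x ℤ.+ c) ℤ.* 0ℤ
  base = solve-∀
eval-timesLinear c k (q ∷ p) x =
  trans (cong (λ s → k ℤ.+ c ℤ.* q ℤ.+ x ℤ.* s) (eval-timesLinear c q p x)) (regroup c k q x (eval p x))
  where
  regroup : ∀ c k q x y → k ℤ.+ c ℤ.* q ℤ.+ x ℤ.* (q ℤ.+ (x ℤ.+ c) ℤ.* y) ≡
                        k ℤ.+ (x ℤ.+ c) ℤ.* (q ℤ.+ x ℤ.* y)
  regroup = solve-∀

eval-scale : ∀ c p x → eval (List.map (c ℤ.*_) p) x ≡ c ℤ.* eval p x
eval-scale c []      x = sym (ℤ.*-zeroʳ c)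
eval-scale c (q ∷ p) x = trans (cong (λ s → c ℤ.* q ℤ.+ x ℤ.* s) (eval-scale c p x)) (regroup c q x (eval p x))
  where
  regroup : ∀ c q x y → c ℤ.* q ℤ.+ x ℤ.* (c ℤ.* y) ≡ c ℤ.* (q ℤ.+ x ℤ.* y)
  regroup = solve-∀

-- The falling factorial (x + M)(x + M − 1)⋯(x + M − k + 1).
falling : ℕ → ℕ → Poly
falling M zero    = 1ℤ ∷ []
falling M (suc k) = timesLinear (+ M ℤ.- + k) 0ℤ (falling M k)

eval-falling : ∀ M k n → eval (falling M k) (+ n) ≡ + (k !) ℤ.* + ((n ℕ.+ M) C k)
eval-falling M zero    n rewrite nC0≡1 (n ℕ.+ M) = one (+ n)
  where
  one : ∀ x → 1ℤ ℤ.+ x ℤ.* 0ℤ ≡ 1ℤ ℤ.* 1ℤ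
  one = solve-∀
eval-falling M (suc k) n = begin
  eval (falling M (suc k)) (+ n)
    ≡⟨ trans (eval-timesLinear (+ M ℤ.- + k) 0ℤ (falling M k) (+ n)) (ℤ.+-identityˡ _) ⟩
  (+ n ℤ.+ (+ M ℤ.- + k)) ℤ.* eval (falling M k) (+ n)
    ≡⟨ cong (λ s → (+ n ℤ.+ (+ M ℤ.- + k)) ℤ.* s) (eval-falling M k n) ⟩
  (+ n ℤ.+ (+ M ℤ.- + k)) ℤ.* (f ℤ.* b)
    ≡⟨ expand (+ n) (+ M) (+ k) f b ⟩
  f ℤ.* ((+ n ℤ.+ + M) ℤ.* b ℤ.- + k ℤ.* b)
    ≡⟨ cong (λ s → f ℤ.* (s ℤ.- + k ℤ.* b)) absorb ⟨
  f ℤ.* ((+ suc k ℤ.* b′ ℤ.+ + k ℤ.* b) ℤ.- + k ℤ.* b)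
    ≡⟨ contract f (+ suc k) b′ (+ k ℤ.* b) ⟩
  (+ suc k ℤ.* f) ℤ.* b′
    ≡⟨ cong (λ s → s ℤ.* b′) (sym (ℤ.pos-* (suc k) (k !))) ⟩
  + (suc k !) ℤ.* b′ ∎
  where
  open ≡-Reasoning
  N = n ℕ.+ M
  f = + (k !)
  b = + (N C k)
  b′ = + (N C suc k)
  absorb : + suc k ℤ.* b′ ℤ.+ + k ℤ.* b ≡ (+ n ℤ.+ + M) ℤ.* b
  absorb = trans (cong₂ ℤ._+_ (sym (ℤ.pos-* (suc k) (N C suc k))) (sym (ℤ.pos-* k (N C k))))
                 (trans (cong +_ (C-absorb N k)) (ℤ.pos-* N (N C k)))
  expand : ∀ n m k f b → (n ℤ.+ (m ℤ.- k)) ℤ.* (f ℤ.* b) ≡ f ℤ.* ((n ℤ.+ m) ℤ.* b ℤ.- k ℤ.* b)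
  expand = solve-∀
  contract : ∀ f s b c → f ℤ.* ((s ℤ.* b ℤ.+ c) ℤ.- c) ≡ (s ℤ.* f) ℤ.* b
  contract = solve-∀

-- One denominator must serve all coefficients of the recurrence, so the falling factorial is
-- rescaled by the integer M! / k!.
binomialPoly : ∀ M k → k ≤ M → ∃ λ p → ∀ n → eval p (+ n) ≡ + (M !) ℤ.* + ((n ℕ.+ M) C k)
binomialPoly M k k≤M with m≤n⇒m!∣n! k≤M
... | divides q eq = List.map (+ q ℤ.*_) (falling M k) , λ n → trans (eval-scale (+ q) (falling M k) (+ n))
  (trans (cong (λ s → + q ℤ.* s) (eval-falling M k n))
  (trans (sym (ℤ.*-assoc (+ q) (+ (k !)) _))
         (cong (λ s → s ℤ.* + ((n ℕ.+ M) C k)) (trans (sym (ℤ.pos-* q (k !))) (cong +_ (sym eq))))))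

-- The coefficients q (k − 1), ..., q 0, d of a recurrence, lowest shift first.
backwards : (ℕ → Poly) → ℕ → Poly → List Poly
backwards q zero    d = d ∷ []
backwards q (suc k) d = q k ∷ backwards q k d

combination-backwards : ∀ q k d a s x → combination (backwards q k d) a s x ≡
  Σ[ List.downFrom k ] (λ i → eval (q i) x ℤ.* a ((s ℕ.+ k) ∸ suc i)) ℤ.+ eval d x ℤ.* a (s ℕ.+ k)
combination-backwards q zero    d a s x rewrite ℕ.+-identityʳ s = ℤ.+-comm (eval d x ℤ.* a s) 0ℤ
combination-backwards q (suc k) d a s x = trans
  (cong₂ ℤ._+_ (cong (λ j → eval (q k) x ℤ.* a j) (sym (m+n∸n≡m s (suc k))))
    (trans (combination-backwards q k d a (suc s) x)
           (cong (λ j → Σ[ List.downFrom k ] (λ i → eval (q i) x ℤ.* a (j ∸ suc i)) ℤ.+ eval d x ℤ.* a j)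
                 (sym (ℕ.+-suc s k)))))
  (sym (ℤ.+-assoc (eval (q k) x ℤ.* a ((s ℕ.+ suc k) ∸ suc k)) _ _))

binomialRecurrence⇒PRecursive : ∀ (a : ℕ → ℕ) M →
  (∀ n → + a (suc n) ≡ Σ[ List.downFrom M ] (λ i → + (n C i) ℤ.* + a (n ∸ i))) → PRecursive a
binomialRecurrence⇒PRecursive a M rec =
  -- The recurrence is read at n + M, where the index n + M - i is not truncated for i < M. The
  -- lowest index is then n + 1, so a(n) receives the zero polynomial.
  combination⇒PRecursive ([] ∷ backwards q M d) (there (nonzero M)) λ n → begin
    0ℤ ℤ.* + a n ℤ.+ combination (backwards q M d) (+_ ∘ a) (suc n) (+ n)
      ≡⟨ ℤ.+-identityˡ _ ⟩
    combination (backwards q M d) (+_ ∘ a) (suc n) (+ n)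
      ≡⟨ combination-backwards q M d (+_ ∘ a) (suc n) (+ n) ⟩
    Σ[ List.downFrom M ] (λ i → eval (q i) (+ n) ℤ.* + a (n ℕ.+ M ∸ i)) ℤ.+ eval d (+ n) ℤ.* + a (suc (n ℕ.+ M))
      ≡⟨ cong₂ ℤ._+_ (Σ-cong (List.downFrom M) (λ {i} i∈ →
                       cong (λ s → s ℤ.* + a (n ℕ.+ M ∸ i)) (eval-q n (∈-downFrom⁻ i∈))))
                     (cong (λ s → eval d (+ n) ℤ.* s) (rec (n ℕ.+ M))) ⟩
    Σ[ List.downFrom M ] (λ i → (D ℤ.* + ((n ℕ.+ M) C i)) ℤ.* + a (n ℕ.+ M ∸ i)) ℤ.+ eval d (+ n) ℤ.* S n
      ≡⟨ cong (λ s → s ℤ.+ eval d (+ n) ℤ.* S n)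
           (trans (Σ-cong (List.downFrom M) (λ {i} _ → ℤ.*-assoc D _ _)) (Σ-* D (List.downFrom M) _)) ⟩
    D ℤ.* S n ℤ.+ eval d (+ n) ℤ.* S n
      ≡⟨ cancel D (+ n) (S n) ⟩
    0ℤ ∎
  where
  open ≡-Reasoning
  D : ℤ
  D = + (M !)
  d : Poly
  d = ℤ.- D ∷ []
  S : ℕ → ℤ
  S n = Σ[ List.downFrom M ] (λ i → + ((n ℕ.+ M) C i) ℤ.* + a (n ℕ.+ M ∸ i))
  q : ℕ → Poly
  -- The recurrence asks only for i < M; beyond M the zero polynomial is a default.
  q i with i ≤? M
  ... | yes i≤M = proj₁ (binomialPoly M i i≤M)
  ... | no _    = []
  eval-q : ∀ n {i} → i < M → eval (q i) (+ n) ≡ D ℤ.* + ((n ℕ.+ M) C i)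
  eval-q n {i} i<M with i ≤? M
  ... | yes i≤M = proj₂ (binomialPoly M i i≤M) n
  ... | no i≰M  = contradiction (<⇒≤ i<M) i≰M
  nonzero : ∀ k → Any NonZeroPoly (backwards q k d)
  nonzero zero    = here (here λ e → ℕ.≢-nonZero⁻¹ (M !) {{M !≢0}} (ℤ.+-injective (ℤ.neg-injective e)))
  nonzero (suc k) = there (nonzero k)
  cancel : ∀ D x s → D ℤ.* s ℤ.+ (ℤ.- D ℤ.+ x ℤ.* 0ℤ) ℤ.* s ≡ 0ℤ
  cancel = solve-∀

-- The patterns of the theorem.

distinctBlocks⇒PRecursive : ∀ {m} (π : Partition m) → (∀ i j → SameBlock (blocks π) i j → i ≡ j) →
                            CountIsPRecursive π
distinctBlocks⇒PRecursive {m} π π-id = CFinite⇒CountIsPRecursive π (fewBlocks m)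
  (fewBlocks-decides π π-id) (fewBlocks-CFinite m)

sameBlocks⇒PRecursive : ∀ {m} (π : Partition (suc m)) → (∀ i j → SameBlock (blocks π) i j) →
                        CountIsPRecursive π
sameBlocks⇒PRecursive {m} π all = number (smallBlocks m) ,
  avoiders-cardinality π (smallBlocks m) (smallBlocks-decides π all) ,
  binomialRecurrence⇒PRecursive (number (smallBlocks m)) m λ n →
    trans (number-total (smallBlocks m) (suc n)) (trans (smallBlocks-recurrence m n)
      (Σ-cong (List.downFrom m) λ {i} _ →
        cong (λ s → + (n C i) ℤ.* s) (sym (number-total (smallBlocks m) (n ∸ i)))))

pairPattern⇒PRecursive : ∀ {N} (π : Partition (suc (suc N))) → PairPattern π → CountIsPRecursive π
pairPattern⇒PRecursive {N} π P = CFinite⇒CountIsPRecursive π (pairFree N)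
  (pairFree-decides π P) (pairFree-CFinite N)

singletons-PRecursive : ∀ m → CountIsPRecursive (singletons m)
singletons-PRecursive m = distinctBlocks⇒PRecursive (singletons m) λ i j p →
  let k , i∈ , j∈ = Any.tabulate⁻ p in trans (x∈⁅y⁆⇒x≡y k i∈) (sym (x∈⁅y⁆⇒x≡y k j∈))

oneBlock-PRecursive : ∀ m 1≤m → CountIsPRecursive (oneBlock m 1≤m)
oneBlock-PRecursive (suc m) 1≤m = sameBlocks⇒PRecursive (oneBlock (suc m) 1≤m) λ i j → here (∈⊤ , ∈⊤)

pairAndSingletons-PRecursive : ∀ m 2≤m → CountIsPRecursive (pairAndSingletons m 2≤m)
pairAndSingletons-PRecursive 1 (s≤s ())
pairAndSingletons-PRecursive (suc (suc N)) 2≤m = pairPattern⇒PRecursive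
  (pairAndSingletons (suc (suc N)) 2≤m) record
  { paired   = here (here , there here)
  ; separate = separate
  }
  where
  in-pair : ∀ {i : Fin (suc N)} → suc i ∈ (⁅ zero ⁆ ∪ ⁅ suc zero ⁆) → i ≡ zero
  in-pair i∈ with x∈p∪q⁻ ⁅ zero ⁆ ⁅ suc zero ⁆ i∈
  ... | inj₁ i∈0 = contradiction (x∈⁅y⁆⇒x≡y zero i∈0) λ ()
  ... | inj₂ i∈1 = Fin.suc-injective (x∈⁅y⁆⇒x≡y (suc zero) i∈1)
  separate : ∀ i j → SameBlock (blocks (pairAndSingletons (suc (suc N)) 2≤m)) (suc i) (suc j) → i ≡ j
  separate i j (here (i∈ , j∈)) = trans (in-pair i∈) (sym (in-pair j∈))
  separate i j (there p) with Any.tabulate⁻ p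
  ... | k , i∈ , j∈ = Fin.suc-injective
    (trans (x∈⁅y⁆⇒x≡y (suc (suc k)) i∈) (sym (x∈⁅y⁆⇒x≡y (suc (suc k)) j∈)))

Ker₃ : ∀ {a b c a′ b′ c′ : ℕ} → (a ≡ b ⇔ a′ ≡ b′) → (a ≡ c ⇔ a′ ≡ c′) → (b ≡ c ⇔ b′ ≡ c′) →
       ∀ i j → Ker (a ∷ b ∷ c ∷ []) i j ⇔ Ker (a′ ∷ b′ ∷ c′ ∷ []) i j
Ker₃ p q r zero             zero             = mk⇔ (λ _ → refl) (λ _ → refl)
Ker₃ p q r zero             (suc zero)       = p
Ker₃ p q r zero             (suc (suc zero)) = q
Ker₃ p q r (suc zero)       zero             = mk⇔ (sym ∘ to p ∘ sym) (sym ∘ from p ∘ sym)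
Ker₃ p q r (suc zero)       (suc zero)       = mk⇔ (λ _ → refl) (λ _ → refl)
Ker₃ p q r (suc zero)       (suc (suc zero)) = r
Ker₃ p q r (suc (suc zero)) zero             = mk⇔ (sym ∘ to q ∘ sym) (sym ∘ from q ∘ sym)
Ker₃ p q r (suc (suc zero)) (suc zero)       = mk⇔ (sym ∘ to r ∘ sym) (sym ∘ from r ∘ sym)
Ker₃ p q r (suc (suc zero)) (suc (suc zero)) = mk⇔ (λ _ → refl) (λ _ → refl)

both : ∀ {A B : Set} → A → B → A ⇔ B
both a b = mk⇔ (λ _ → b) (λ _ → a)

neither : ∀ {A B : Set} → ¬ A → ¬ B → A ⇔ B
neither ¬a ¬b = mk⇔ (λ a → contradiction a ¬a) (λ b → contradiction b ¬b)

-- The proofs of `RGF p` leave just five words, in clause order 000, 100, 010, 110 and 210. With the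
-- smallest element first these are the partitions 123, 1/23, 13/2, 12/3 and 1/2/3.
three-PRecursive : ∀ (π : Partition 3) {p : Vec ℕ 3} → RGF p →
                   (∀ i j → SameBlock (blocks π) i j ⇔ Ker p i j) → CountIsPRecursive π
three-PRecursive π (z≤n ∷ z≤n ∷ z≤n ∷ []) e = sameBlocks⇒PRecursive π λ i j →
  from (e i j) (trans (Vec.lookup-replicate i 0) (sym (Vec.lookup-replicate j 0)))
three-PRecursive π (s≤s z≤n ∷ z≤n ∷ z≤n ∷ []) e = CFinite⇒CountIsPRecursive π lumpFree
  (lumpFree-decides π λ {a} {b} {c} → mk⇔
    (λ μ → (λ a≡b → 1+n≢0 (to (e zero (suc zero)) (to (μ zero (suc zero)) a≡b)))
         , from (μ (suc zero) (suc (suc zero))) (from (e (suc zero) (suc (suc zero))) refl))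
    (λ { (a≢b , refl) i j → let k = Ker₃ (neither a≢b 1+n≢0) (neither a≢b 1+n≢0) (both refl refl) i j in
         mk⇔ (from (e i j) ∘ to k) (from k ∘ to (e i j)) }))
  lumpFree-CFinite
three-PRecursive π (z≤n ∷ s≤s z≤n ∷ z≤n ∷ []) e = CFinite⇒CountIsPRecursive π layered
  (layered-decides π λ {a} {b} {c} → mk⇔
    (λ μ → (λ a≡b → 0≢1+n (to (e zero (suc zero)) (to (μ zero (suc zero)) a≡b)))
         , from (μ zero (suc (suc zero))) (from (e zero (suc (suc zero))) refl))
    (λ { (a≢b , refl) i j → let k = Ker₃ (neither a≢b 0≢1+n) (both refl refl) (neither (a≢b ∘ sym) 1+n≢0) i j in
         mk⇔ (from (e i j) ∘ to k) (from k ∘ to (e i j)) }))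
  layered-CFinite
three-PRecursive π (s≤s z≤n ∷ s≤s z≤n ∷ z≤n ∷ []) e = pairPattern⇒PRecursive π record
  { paired   = from (e zero (suc zero)) refl
  ; separate = λ i j → to Ker-Distinct (((λ ()) ∷ []) ∷ [] ∷ []) i j ∘ to (e (suc i) (suc j))
  }
three-PRecursive π (s≤s (s≤s z≤n) ∷ s≤s z≤n ∷ z≤n ∷ []) e = distinctBlocks⇒PRecursive π λ i j →
  to Ker-Distinct (((λ ()) ∷ (λ ()) ∷ []) ∷ ((λ ()) ∷ []) ∷ [] ∷ []) i j ∘ to (e i j)

theorem3p7 : (∀ (m : ℕ) (1≤m : 1 ≤ m) →
    CountIsPRecursive (singletons m) ×
    CountIsPRecursive (oneBlock m 1≤m) ×
    (∀ (2≤m : 2 ≤ m) → CountIsPRecursive (pairAndSingletons m 2≤m))) ×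
    (∀ (π : Partition 3) → CountIsPRecursive π)
theorem3p7 =
  (λ m 1≤m → singletons-PRecursive m , oneBlock-PRecursive m 1≤m , pairAndSingletons-PRecursive m) ,
  (λ π → three-PRecursive π (word-RGF π) (word-Ker π))
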